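{- Let $G$ be a finite group which is not nilpotent, let $S$ be a finite set, and let $\alpha$ be a faithful (left) action of $G$ on $S$, written $(g,s)\mapsto gs$. Let $\mathbb{A}(G,S,\alpha)^\ast$ be the algebra with universe $G\times S$ and two basic operations: a unary operation $f$ given by $f((g,s))=(g,gs)$ and a binary operation $d$ given by $d((g_1,s_1),(g_2,s_2))=(g_1,s_2)$. Then $\mathbb{A}(G,S,\alpha)^\ast$ is inherently nonfinitely based in the finite sense: for every $n\geq 1$ there exists $d\geq 1$ such that $\mathscr{V}(\mathbb{A}(G,S,\alpha)^\ast)^{(n)}$ contains arbitrarily large finite $d$-generated algebras.
   Context: For a finite algebra $\mathbf{A}$ (with finitely many basic operations) and $n\geq 1$, $\mathscr{V}(\mathbf{A})^{(n)}$ denotes the class of all algebras (in the same signature) satisfying every identity in at most $n$ variables that is valid in $\mathbf{A}$. "Arbitrarily large finite $d$-generated algebras" means: for every $\ell>0$ there is a finite algebra in the class, generated by at most $d$ elements, with at least $\ell$ elements. -}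

module Defs where

open import Level using (0ℓ)
open import Data.Nat using (ℕ; zero; suc; _≤_)
open import Data.Fin using (Fin)
open import Data.Product using (Σ; ∃; _×_; _,_)
open import Relation.Binary.PropositionalEquality using (_≡_)
open import Algebra.Structures using (IsGroup)
open import Function.Bundles using (_↔_)

record FiniteGroup : Set₁ where
  field
    Carrier : Set
    _∙_     : Carrier → Carrier → Carrier
    ε       : Carrier
    _⁻¹     : Carrier → Carrier
    isGroup : IsGroup _≡_ _∙_ ε _⁻¹
    size    : ℕ
    enum    : Fin size ↔ Carrier

  comm : Carrier → Carrier → Carrier
  comm x g = ((x ∙ g) ∙ (x ⁻¹)) ∙ (g ⁻¹)

  -- upper central series: Z 0 = {ε},
  -- x ∈ Z (i+1)  iff  [x , g] ∈ Z i for all g   (i.e. Z(i+1)/Z i = Z(G / Z i))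
  Z : ℕ → Carrier → Set
  Z zero    x = x ≡ ε
  Z (suc i) x = ∀ g → Z i (comm x g)

  IsNilpotent : Set
  IsNilpotent = ∃ λ c → ∀ x → Z c x

record FaithfulAction (G : FiniteGroup) (S : Set) : Set where
  open FiniteGroup G
  field
    act      : Carrier → S → S
    act-ε    : ∀ s → act ε s ≡ s
    act-∙    : ∀ g h s → act (g ∙ h) s ≡ act g (act h s)
    faithful : ∀ g → (∀ s → act g s ≡ s) → g ≡ ε

record Alg : Set₁ where
  field
    Carrier : Set
    f       : Carrier → Carrier
    d       : Carrier → Carrier → Carrier

data Term (n : ℕ) : Set where
  var : Fin n → Term n
  f   : Term n → Term n
  d   : Term n → Term n → Term n

⟦_⟧ : ∀ {n} → Term n → (A : Alg) → (Fin n → Alg.Carrier A) → Alg.Carrier A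
⟦ var i ⟧ A ρ = ρ i
⟦ f t   ⟧ A ρ = Alg.f A (⟦ t ⟧ A ρ)
⟦ d s t ⟧ A ρ = Alg.d A (⟦ s ⟧ A ρ) (⟦ t ⟧ A ρ)

_⊨_≈_ : ∀ {n} → Alg → Term n → Term n → Set
A ⊨ s ≈ t = ∀ ρ → ⟦ s ⟧ A ρ ≡ ⟦ t ⟧ A ρ

-- B ∈ 𝒱(A)^(n): B satisfies every identity in (at most) n variables valid in A
-- (identities in fewer variables are identities in Fin n with unused variables)
InVarN : ℕ → Alg → Alg → Set
InVarN n A B = (s t : Term n) → A ⊨ s ≈ t → B ⊨ s ≈ t

FiniteOfSizeAtLeast : ℕ → Alg → Set
FiniteOfSizeAtLeast ℓ B = Σ ℕ λ m → (ℓ ≤ m) × (Fin m ↔ Alg.Carrier B)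

Generated : ℕ → Alg → Set
Generated k B = Σ (Fin k → Alg.Carrier B) λ gens →
  ∀ b → Σ (Term k) λ t → ⟦ t ⟧ B gens ≡ b

𝔸* : (G : FiniteGroup) (S : Set) → FaithfulAction G S → Alg
𝔸* G S α = record
  { Carrier = FiniteGroup.Carrier G × S
  ; f = λ { (g , s) → (g , FaithfulAction.act α g s) }
  ; d = λ { (g₁ , s₁) (g₂ , s₂) → (g₁ , s₂) }
  }

InherentlyNFBFinite : Alg → Set₁
InherentlyNFBFinite A =
  (n : ℕ) → 1 ≤ n →
  Σ ℕ λ k → (1 ≤ k) ×
    ((ℓ : ℕ) → 0 Data.Nat.< ℓ →
      Σ Alg λ B → InVarN n A B × FiniteOfSizeAtLeast ℓ B × Generated k B)

{-# OPTIONS --safe #-}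
module Submission where

-- A term of 𝔸* amounts to its first variable, its last variable and a word in between, so an algebra
-- Letter × State built from letters acting on states satisfies the n-variable identities of 𝔸* as soon as
-- any n of its letters satisfy the laws of G on words.
--
-- A finite nonnilpotent G has an abelian section A / N on which some y ∈ G acts without fixed points. (In a
-- minimal nonnilpotent section with trivial centre, if there were no proper normal subgroup, the maximal
-- subgroups would meet trivially and the conjugates of two of them would overfill the section, as in
-- Schmidt's theorem. Hence there is a normal maximal subgroup M; take A to be its centre and y outside M.)
-- It yields primes p ≠ q, a power z of y and v in the section with p v = 0, z^q v = v and
-- v + z v + … + z^(q−1) v = 0. Fourier inversion over (ℤ/q)ᵐ then shows that
-- the wreath product of C_p by C_q^m satisfies the laws of G, for every m.
--
-- The letters are generators of C_q^m, m = n + 1, and two lamps: permutations α and β of order p of a finite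
-- set F, acting on the fibre F over the origin and over a point that differs from the origin in every
-- coordinate. Any n letters omit a generator of C_q^m, so that no orbit meets both lamps and the laws of the
-- wreath product hold. All letters together act transitively, and F can be as large as desired.

open import Defs hiding (var; f; d)
open import Level using (0ℓ)
open import Algebra.Bundles using (AbelianGroup; Group)
open import Algebra.Core using (Op₁; Op₂)
import Algebra.Properties.AbelianGroup as AbelianGroupProperties
import Algebra.Properties.CommutativeMonoid.Mult as CommutativeMult
import Algebra.Properties.Group as GroupProperties
import Algebra.Properties.Monoid.Mult as Mult
import Algebra.Properties.Semiring.Sum as SemiringSum
import Algebra.Solver.CommutativeMonoid as CommutativeMonoidSolver
open import Algebra.Structures using (IsGroup)
open import Data.Bool using (Bool; true; false; not)
import Data.Bool.Properties as Bool
open import Data.Empty using (⊥; ⊥-elim)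
open import Data.Fin using (Fin; zero; suc; toℕ)
open import Data.Fin.Permutation using (permutation)
import Data.Fin.Properties as Fin
open import Data.Fin.Subset using (Subset; inside; outside; _∈_; _∉_; _⊆_; _⊂_; _∩_; _─_; ∣_∣; ⁅_⁆; ⊤)
open import Data.Fin.Subset.Properties using (_∈?_; _⊆?_; _⊂?_; anySubset?; p─q⊆p; x∈p∧x∉q⇒x∈p─q; p⊂q⇒∣p∣<∣q∣; p∩q⊆p; p∩q⊆q; x∈p∩q⁺; x∈p∩q⁻; x∈⁅x⁆; x∈⁅y⁆⇒x≡y; ∈⊤; ⊆⊤)
open import Data.List using (List; []; _∷_)
open import Data.List.Relation.Unary.All using (All; []; _∷_)
open import Data.Nat as ℕ using (ℕ; zero; suc; _+_; _*_; _∸_; _^_; _≤_; _<_; z≤n; s≤s)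
open import Data.Nat.Coprimality using (Coprime; coprime-Bézout)
open import Data.Nat.Divisibility using (_∣_; _∣?_; divides; divides-refl; ∣⇒≤; ∣-refl; ∣1⇒≡1; _∣0; ∣m∣n⇒∣m+n; ∣m+n∣m⇒∣n)
open import Data.Nat.DivMod using (_%_; _/_; _mod_; m%n<n; m≡m%n+[m/n]*n; m%n%n≡m%n; [m+n]%n≡m%n; m<n⇒m%n≡m; %-distribˡ-+)
open import Data.Nat.GCD using (module Bézout)
open import Data.Nat.Induction using (Acc; acc; <-wellFounded)
open import Data.Nat.ListAction using (product)
open import Data.Nat.Primality using (Prime; euclidsLemma; prime⇒irreducible; prime⇒nonZero; ¬prime[0]; ¬prime[1])
open import Data.Nat.Primality.Factorisation using (factorise)
import Data.Nat.Properties as ℕ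
open import Data.Nat.Tactic.RingSolver using (solve-∀)
open import Data.Product using (Σ; ∃; _×_; _,_; proj₁; proj₂)
open import Data.Product.Function.NonDependent.Propositional using (_×-↔_)
open import Data.Sum using (_⊎_; inj₁; inj₂)
open import Data.Sum.Function.Propositional using (_⊎-↔_)
import Data.Sum.Properties as Sum
open import Data.Vec as Vec using (Vec; []; _∷_; lookup; tabulate; replicate; updateAt; zipWith)
open import Data.Vec.Membership.Propositional.Properties using (∈-lookup)
import Data.Vec.Properties as Vec
import Data.Vec.Relation.Unary.All as VAll
open VAll using ([]; _∷_)
open import Function using (_∘_; id; const)
open import Function.Bundles using (_↔_; mk↔ₛ′; Inverse)
open import Function.Properties.Inverse using (↔-refl; ↔-trans)
open import Relation.Binary.PropositionalEquality as ≡ using (_≡_; _≢_)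
import Relation.Binary.Reasoning.Setoid as SetoidReasoning
import Relation.Binary.Reflection as Reflection
open import Relation.Nullary using (¬_; Dec; yes; no; does; contradiction)
open import Relation.Nullary.Decidable using (_×-dec_; _⊎-dec_; _→-dec_; ¬?; dec-true; map′; decidable-stable)

-- Endomorphisms of abelian groups

iter : {A : Set} → (A → A) → ℕ → A → A
iter f zero    x = x
iter f (suc k) x = f (iter f k x)

iter-+ : {A : Set} (f : A → A) → ∀ m k x → iter f (m + k) x ≡ iter f m (iter f k x)
iter-+ f zero    k x = ≡.refl
iter-+ f (suc m) k x = ≡.cong f (iter-+ f m k x)

iter-* : {A : Set} (f : A → A) → ∀ m k x → iter f (m * k) x ≡ iter (iter f k) m x
iter-* f zero    k x = ≡.refl
iter-* f (suc m) k x = ≡.trans (iter-+ f k (m * k) x) (≡.cong (iter f k) (iter-* f m k x))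

iter-suc : {A : Set} (f : A → A) → ∀ k x → iter f k (f x) ≡ f (iter f k x)
iter-suc f zero    x = ≡.refl
iter-suc f (suc k) x = ≡.cong f (iter-suc f k x)

binom : ℕ → ℕ → ℕ
binom n       zero    = 1
binom zero    (suc i) = 0
binom (suc n) (suc i) = binom n i + binom n (suc i)

binom-> : ∀ n d → binom n (suc (d + n)) ≡ 0
binom-> zero    d = ≡.refl
binom-> (suc n) d = ≡.cong₂ _+_
  (≡.trans (≡.cong (binom n) (ℕ.+-suc d n)) (binom-> n d))
  (≡.trans (≡.cong (binom n ∘ suc) (ℕ.+-suc d n)) (binom-> n (suc d)))

binom-diagonal : ∀ n → binom n n ≡ 1
binom-diagonal zero    = ≡.refl
binom-diagonal (suc n) = ≡.cong₂ _+_ (binom-diagonal n) (binom-> n 0)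

-- In this product form Euclid's lemma yields p ∣ `binom p (suc i)` without any division.
binom-absorb : ∀ n i → suc i * binom (suc n) (suc i) ≡ suc n * binom n i
binom-absorb zero    zero    = ≡.refl
binom-absorb zero    (suc i) = ℕ.*-zeroʳ i
binom-absorb (suc n) zero    = ≡.cong suc (≡.trans (binom-absorb n zero) ≡.refl)
binom-absorb (suc n) (suc i) = begin
  suc (suc i) * (x + y)         ≡⟨ expand i x y ⟩
  suc i * x + x + suc (suc i) * y ≡⟨ ≡.cong₂ (λ a b → a + x + b) (binom-absorb n i) (binom-absorb n (suc i)) ⟩
  suc n * binom n i + x + suc n * binom n (suc i) ≡⟨ factor n (binom n i) (binom n (suc i)) ⟩
  suc (suc n) * x               ∎
  where
  open ≡.≡-Reasoning
  x = binom (suc n) (suc i)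
  y = binom (suc n) (suc (suc i))
  expand : ∀ i x y → suc (suc i) * (x + y) ≡ suc i * x + x + suc (suc i) * y
  expand = solve-∀
  factor : ∀ n a b → suc n * a + (a + b) + suc n * b ≡ suc (suc n) * (a + b)
  factor = solve-∀

prime∣binom : ∀ {p} → Prime p → ∀ i → suc i < p → p ∣ binom p (suc i)
prime∣binom {zero}  pr i ()
prime∣binom {suc n} pr i i<p
  with euclidsLemma (suc i) (binom (suc n) (suc i)) pr
         (divides (binom n i) (≡.trans (binom-absorb n i) (ℕ.*-comm (suc n) (binom n i))))
... | inj₁ p∣i = ⊥-elim (ℕ.<⇒≱ i<p (∣⇒≤ p∣i))
... | inj₂ p∣b = p∣b

prime-coprime : ∀ {p d} → Prime p → ¬ p ∣ d → Coprime p d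
prime-coprime pr p∤d (i∣p , i∣d) with prime⇒irreducible pr i∣p
... | inj₁ i≡1 = i≡1
... | inj₂ ≡.refl = ⊥-elim (p∤d i∣d)

distinct-primes-∤ : ∀ {p q} → Prime p → Prime q → q ≢ p → ¬ p ∣ q
distinct-primes-∤ pp pq q≢p p∣q with prime⇒irreducible pq p∣q
... | inj₁ ≡.refl = ¬prime[1] pp
... | inj₂ p≡q    = q≢p (≡.sym p≡q)

∤-^ : ∀ {p q} → Prime p → ¬ p ∣ q → ∀ m → ¬ p ∣ q ^ m
∤-^ pp p∤q zero    p∣1 with ∣1⇒≡1 p∣1
... | ≡.refl = ¬prime[1] pp
∤-^ pp p∤q (suc m) p∣ with euclidsLemma _ _ pp p∣
... | inj₁ p∣q = p∤q p∣q
... | inj₂ p∣r = ∤-^ pp p∤q m p∣r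

-- Raising both sides by multiples of p avoids subtraction, and it is the form in which iterates of
-- a map of order p are compared.
Congruent : ℕ → ℕ → ℕ → Set
Congruent p a b = ∃ λ k → ∃ λ l → a + k * p ≡ b + l * p

-- By symmetry the smaller number may be put first, which leaves only the difference d to be
-- treated.
congruent-of-≤ : ∀ p (R : ℕ → ℕ → Set) → (∀ {a b} → R a b → R b a) →
                 (∀ a d → R a (a + d) → p ∣ d) → ∀ {a b} → R a b → Congruent p a b
congruent-of-≤ p R R-sym div {a} {b} r with ℕ.≤-total a b
... | inj₁ a≤b with ℕ.m≤n⇒∃[o]m+o≡n a≤b
...   | d , ≡.refl with div a d r
...     | divides k ≡.refl = k , 0 , ≡.sym (ℕ.+-identityʳ _)
congruent-of-≤ p R R-sym div {a} {b} r | inj₂ b≤a with ℕ.m≤n⇒∃[o]m+o≡n b≤a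
... | d , ≡.refl with div b d (R-sym r)
...   | divides k ≡.refl = 0 , k , ℕ.+-identityʳ _

dot : ∀ {m} → Vec ℕ m → Vec ℕ m → ℕ
dot []       []       = 0
dot (e ∷ es) (d ∷ ds) = e * d + dot es ds

dot-+ : ∀ {m} (es ds cs : Vec ℕ m) → dot es (zipWith _+_ ds cs) ≡ dot es ds + dot es cs
dot-+ []       []       []       = ≡.refl
dot-+ (e ∷ es) (d ∷ ds) (c ∷ cs) = ≡.trans (≡.cong (e * (d + c) +_) (dot-+ es ds cs)) (lemma e d c _ _)
  where
  lemma : ∀ e d c x y → e * (d + c) + (x + y) ≡ e * d + x + (e * c + y)
  lemma = solve-∀

module _ (q : ℕ) where

  AllDivide : ∀ {m} → Vec ℕ m → Set
  AllDivide = VAll.All (q ∣_)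

  allDivide? : ∀ {m} (d : Vec ℕ m) → Dec (AllDivide d)
  allDivide? = VAll.all? (q ∣?_)

  -- The number of entries congruent to − τ.
  hits : ∀ {m} → Vec ℕ m → List (Vec ℕ m) → ℕ
  hits τ []       = 0
  hits τ (d ∷ ds) with allDivide? (zipWith _+_ τ d)
  ... | yes _ = suc (hits τ ds)
  ... | no _  = hits τ ds

module Endomorphisms (U : AbelianGroup 0ℓ 0ℓ) where
  open AbelianGroup U renaming
    (Carrier to C; _∙_ to _⊹_; ε to 0#; _⁻¹ to -_; ∙-cong to ⊹-cong; ∙-congˡ to ⊹-congˡ; ∙-congʳ to ⊹-congʳ;
     assoc to ⊹-assoc; comm to ⊹-comm; identityˡ to ⊹-identityˡ; identityʳ to ⊹-identityʳ) public
  open AbelianGroupProperties U using (identityʳ-unique; ∙-cancelˡ; ⁻¹-∙-comm)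
  open CommutativeMult commutativeMonoid using () renaming
    (_×_ to infixr 8 _·_; ×-congʳ to ·-congʳ; ×-congˡ to ·-congˡ; ×-homo-+ to ·-homo-+; ×-assocˡ to ·-assocˡ; ×-distrib-+ to ·-distrib-⊹) public
  open SetoidReasoning setoid
  open CommutativeMonoidSolver commutativeMonoid using (solve; _⊕_; _⊜_)

  ·-zero : ∀ n → n · 0# ≈ 0#
  ·-zero zero    = refl
  ·-zero (suc n) = trans (⊹-identityˡ _) (·-zero n)

  ·-swap : ∀ m n x → m · n · x ≈ n · m · x
  ·-swap m n x = trans (·-assocˡ x m n) (trans (·-congˡ (ℕ.*-comm m n)) (sym (·-assocˡ x n m)))

  ∣-kills : ∀ {p c x} → p ∣ c → p · x ≈ 0# → c · x ≈ 0#
  ∣-kills {p} {x = x} (divides-refl k) px≈0 = trans (sym (·-assocˡ x k p)) (trans (·-congʳ k px≈0) (·-zero k))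

  coprime-kills : ∀ {p d x} → Coprime p d → p · x ≈ 0# → d · x ≈ 0# → x ≈ 0#
  coprime-kills {p} {d} {x} cop px dx with coprime-Bézout cop
  ... | Bézout.+- a b eq = begin
    x                       ≈⟨ ⊹-identityʳ x ⟨
    x ⊹ 0#                  ≈⟨ ⊹-congˡ (∣-kills {d} {b * d} (divides-refl b) dx) ⟨
    suc (b * d) · x         ≈⟨ ·-congˡ eq ⟩
    (a * p) · x             ≈⟨ ∣-kills {p} (divides-refl a) px ⟩
    0#                      ∎
  ... | Bézout.-+ a b eq = begin
    x                       ≈⟨ ⊹-identityʳ x ⟨
    x ⊹ 0#                  ≈⟨ ⊹-congˡ (∣-kills {p} {a * p} (divides-refl a) px) ⟨
    suc (a * p) · x         ≈⟨ ·-congˡ eq ⟩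
    (b * d) · x             ≈⟨ ∣-kills {d} (divides-refl b) dx ⟩
    0#                      ∎

  congruent-of-· : ∀ {p x a b} → Prime p → p · x ≈ 0# → ¬ x ≈ 0# → a · x ≈ b · x → Congruent p a b
  congruent-of-· {p} {x} pr px x≉0 = congruent-of-≤ p (λ a b → a · x ≈ b · x) sym λ a d eq →
    decidable-stable (p ∣? d) λ p∤d → x≉0 (coprime-kills (prime-coprime pr p∤d) px
      (identityʳ-unique (a · x) (d · x) (trans (sym (·-homo-+ x a d)) (sym eq))))

  Sum : ℕ → (ℕ → C) → C
  Sum zero    F = 0#
  Sum (suc k) F = Sum k F ⊹ F k

  Sum-cong : ∀ k {F G : ℕ → C} → (∀ i → F i ≈ G i) → Sum k F ≈ Sum k G
  Sum-cong zero    eq = refl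
  Sum-cong (suc k) eq = ⊹-cong (Sum-cong k eq) (eq k)

  Sum-shift : ∀ k F → F 0 ⊹ Sum k (F ∘ suc) ≈ Sum k F ⊹ F k
  Sum-shift zero    F = ⊹-comm _ _
  Sum-shift (suc k) F = trans (sym (⊹-assoc _ _ _)) (⊹-congʳ (Sum-shift k F))

  Sum-⊹ : ∀ k F G → Sum k (λ i → F i ⊹ G i) ≈ Sum k F ⊹ Sum k G
  Sum-⊹ zero    F G = sym (⊹-identityˡ _)
  Sum-⊹ (suc k) F G = trans (⊹-congʳ (Sum-⊹ k F G))
    (solve 4 (λ a b c d → (a ⊕ b) ⊕ (c ⊕ d) ⊜ (a ⊕ c) ⊕ (b ⊕ d)) refl _ _ _ _)

  Sum-const : ∀ k x → Sum k (λ _ → x) ≈ k · x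
  Sum-const zero    x = refl
  Sum-const (suc k) x = trans (⊹-comm _ _) (⊹-congˡ (Sum-const k x))

  Sum-zero : ∀ k → Sum k (λ _ → 0#) ≈ 0#
  Sum-zero k = trans (Sum-const k 0#) (·-zero k)

  record IsEndo (ω : C → C) : Set where
    field
      cong : ∀ {x y} → x ≈ y → ω x ≈ ω y
      homo : ∀ x y → ω (x ⊹ y) ≈ ω x ⊹ ω y

    homo-0 : ω 0# ≈ 0#
    homo-0 = identityʳ-unique (ω 0#) (ω 0#) (trans (sym (homo 0# 0#)) (cong (⊹-identityˡ 0#)))

    homo-· : ∀ k x → ω (k · x) ≈ k · ω x
    homo-· zero    x = homo-0
    homo-· (suc k) x = trans (homo x _) (⊹-congˡ (homo-· k x))

    homo-Sum : ∀ k F → ω (Sum k F) ≈ Sum k (ω ∘ F)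
    homo-Sum zero    F = homo-0
    homo-Sum (suc k) F = trans (homo _ _) (⊹-congʳ (homo-Sum k F))

    torsion : ∀ p {x} → p · x ≈ 0# → p · ω x ≈ 0#
    torsion p {x} px = trans (sym (homo-· p x)) (trans (cong px) homo-0)

  open IsEndo public

  iter-isEndo : ∀ {ω} → IsEndo ω → ∀ k → IsEndo (iter ω k)
  iter-isEndo E zero    = record { cong = id ; homo = λ _ _ → refl }
  iter-isEndo E (suc k) = record
    { cong = λ eq → cong E (cong (iter-isEndo E k) eq)
    ; homo = λ x y → trans (cong E (homo (iter-isEndo E k) x y)) (homo E _ _) }

  ·-isEndo : ∀ p → IsEndo (p ·_)
  ·-isEndo p = record { cong = ·-congʳ p ; homo = λ x y → ·-distrib-⊹ x y p }

  iter-comm : ∀ (ω : C → C) j k x → iter ω j (iter ω k x) ≈ iter ω k (iter ω j x)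
  iter-comm ω j k x = reflexive (≡.trans (≡.sym (iter-+ ω j k x))
    (≡.trans (≡.cong (λ i → iter ω i x) (ℕ.+-comm j k)) (iter-+ ω k j x)))

  iter-fixed : ∀ {ω} → IsEndo ω → ∀ k {x} → ω x ≈ x → iter ω k x ≈ x
  iter-fixed E zero    fx = refl
  iter-fixed E (suc k) fx = trans (cong E (iter-fixed E k fx)) fx

  iter-*-fixed : ∀ {ω} → IsEndo ω → ∀ j k {x} → iter ω k x ≈ x → iter ω (j * k) x ≈ x
  iter-*-fixed {ω} E j k {x} fx = trans (reflexive (iter-* ω j k x)) (iter-fixed (iter-isEndo E k) j fx)

  -- By Bézout some multiples of j and k differ by one. Both iterates fix x, so one further
  -- application of ω leads from the smaller to the larger without an inverse of ω.
  fixed-by-coprime : ∀ {ω} → IsEndo ω → ∀ {j k x} → Coprime j k → iter ω j x ≈ x → iter ω k x ≈ x → ω x ≈ x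
  fixed-by-coprime {ω} E {j} {k} {x} cop fj fk with coprime-Bézout cop
  ... | Bézout.+- a b eq = trans (cong E (sym (iter-*-fixed E b k fk)))
    (trans (reflexive (≡.cong (λ i → iter ω i x) eq)) (iter-*-fixed E a j fj))
  ... | Bézout.-+ a b eq = trans (cong E (sym (iter-*-fixed E a j fj)))
    (trans (reflexive (≡.cong (λ i → iter ω i x) eq)) (iter-*-fixed E b k fk))

  module Unipotent {θ : C → C} (E : IsEndo θ) where

    δ : C → C
    δ x = θ x ⊹ - x

    δ-isEndo : IsEndo δ
    δ-isEndo = record
      { cong = λ eq → ⊹-cong (cong E eq) (⁻¹-cong eq)
      ; homo = λ x y → trans (⊹-cong (homo E x y) (sym (⁻¹-∙-comm x y)))
                 (solve 4 (λ a b c d → (a ⊕ b) ⊕ (c ⊕ d) ⊜ (a ⊕ c) ⊕ (b ⊕ d)) refl _ _ _ _) }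

    θ≈id+δ : ∀ x → θ x ≈ x ⊹ δ x
    θ≈id+δ x = begin
      θ x              ≈⟨ ⊹-identityʳ _ ⟨
      θ x ⊹ 0#         ≈⟨ ⊹-congˡ (inverseʳ x) ⟨
      θ x ⊹ (x ⊹ - x)  ≈⟨ solve 3 (λ a b c → a ⊕ (b ⊕ c) ⊜ b ⊕ (a ⊕ c)) refl _ _ _ ⟩
      x ⊹ (θ x ⊹ - x)  ∎

    -- P c m u = Σ_{i<m} c i · δⁱ u
    P : (ℕ → ℕ) → ℕ → C → C
    P c zero    u = 0#
    P c (suc m) u = c 0 · u ⊹ P (c ∘ suc) m (δ u)

    P-+ : ∀ c c′ m u → P (λ i → c i + c′ i) m u ≈ P c m u ⊹ P c′ m u
    P-+ c c′ zero    u = sym (⊹-identityˡ _)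
    P-+ c c′ (suc m) u = trans (⊹-cong (·-homo-+ u (c 0) (c′ 0)) (P-+ (c ∘ suc) (c′ ∘ suc) m (δ u)))
      (solve 4 (λ a b c d → (a ⊕ b) ⊕ (c ⊕ d) ⊜ (a ⊕ c) ⊕ (b ⊕ d)) refl _ _ _ _)

    P-δ : ∀ c m u → P c m (δ u) ≈ δ (P c m u)
    P-δ c zero    u = sym (homo-0 δ-isEndo)
    P-δ c (suc m) u = sym (trans (homo δ-isEndo _ _)
      (⊹-cong (homo-· δ-isEndo (c 0) u) (sym (P-δ (c ∘ suc) m (δ u)))))

    P-top : ∀ c m u → c m ≡ 0 → P c (suc m) u ≈ P c m u
    P-top c zero    u eq = trans (⊹-identityʳ _) (·-congˡ eq)
    P-top c (suc m) u eq = ⊹-congˡ (P-top (c ∘ suc) m (δ u) eq)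

    binomial : ∀ k u → iter θ k u ≈ P (binom k) (suc k) u
    binomial zero    u = sym (trans (⊹-identityʳ _) (⊹-identityʳ u))
    binomial (suc k) u = begin
      θ (iter θ k u)                                      ≈⟨ cong E (binomial k u) ⟩
      θ (P (binom k) (suc k) u)                           ≈⟨ θ≈id+δ _ ⟩
      -- The first sum is padded by its vanishing coefficient `binom k (suc k)`, so that after
      -- splitting off the constant term both sums have length `suc k` and Pascal's rule applies
      -- termwise.
      P (binom k) (suc k) u ⊹ δ (P (binom k) (suc k) u)   ≈⟨ ⊹-cong (P-top (binom k) (suc k) u (binom-> k 0)) (P-δ (binom k) (suc k) u) ⟨
      (1 · u ⊹ P (binom k ∘ suc) (suc k) (δ u)) ⊹ P (binom k) (suc k) (δ u)
                                                          ≈⟨ solve 3 (λ a b c → (a ⊕ b) ⊕ c ⊜ a ⊕ (c ⊕ b)) refl _ _ _ ⟩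
      1 · u ⊹ (P (binom k) (suc k) (δ u) ⊹ P (binom k ∘ suc) (suc k) (δ u))
                                                          ≈⟨ ⊹-congˡ (P-+ (binom k) (binom k ∘ suc) (suc k) (δ u)) ⟨
      P (binom (suc k)) (suc (suc k)) u                   ∎

    P-mod : ∀ p c m u → (∀ i → i < m → p ∣ c i) → c m ≡ 1 → p · u ≈ 0# → P c (suc m) u ≈ iter δ m u
    P-mod p c zero    u div top pu = trans (⊹-identityʳ _) (trans (·-congˡ top) (⊹-identityʳ u))
    P-mod p c (suc m) u div top pu = trans (⊹-cong (∣-kills (div 0 (s≤s z≤n)) pu)
        (P-mod p (c ∘ suc) m (δ u) (λ i i<m → div (suc i) (s≤s i<m)) top (torsion δ-isEndo p pu)))
      (trans (⊹-identityˡ _) (reflexive (iter-suc δ m u)))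

    -- (θ − 1)ᵖ = θᵖ − 1 on elements killed by p.
    frobenius : ∀ {p u} → Prime p → p · u ≈ 0# → iter θ p u ≈ u → iter δ p u ≈ 0#
    frobenius {zero}  pr = ⊥-elim (¬prime[0] pr)
    frobenius {suc p} {u} pr pu fix = identityʳ-unique u _ (begin
      u ⊹ iter δ (suc p) u                        ≈⟨ ⊹-congˡ (reflexive (iter-suc δ p u)) ⟨
      u ⊹ iter δ p (δ u)                          ≈⟨ ⊹-cong (sym (⊹-identityʳ u))
                                                       (sym (P-mod (suc p) (binom (suc p) ∘ suc) p (δ u)
                                                         (λ i i<p → prime∣binom pr i (s≤s i<p))
                                                         (binom-diagonal (suc p)) (torsion δ-isEndo (suc p) pu))) ⟩
      P (binom (suc p)) (suc (suc p)) u           ≈⟨ binomial (suc p) u ⟨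
      iter θ (suc p) u                            ≈⟨ fix ⟩
      u                                           ∎)

    fixed-of-δ : ∀ {x} → δ x ≈ 0# → θ x ≈ x
    fixed-of-δ {x} eq = trans (θ≈id+δ x) (trans (⊹-congˡ eq) (⊹-identityʳ x))

  trace : (C → C) → ℕ → C → C
  trace θ q x = Sum q (λ e → iter θ e x)

  trace-isEndo : ∀ {θ} → IsEndo θ → ∀ q → IsEndo (trace θ q)
  trace-isEndo E q = record
    { cong = λ eq → Sum-cong q (λ e → cong (iter-isEndo E e) eq)
    ; homo = λ x y → trans (Sum-cong q (λ e → homo (iter-isEndo E e) x y)) (Sum-⊹ q _ _) }

  trace-fixed : ∀ {θ} → IsEndo θ → ∀ q {x} → iter θ q x ≈ x → θ (trace θ q x) ≈ trace θ q x
  -- θ rotates the summands of the trace. With x added on both sides the rotation becomes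
  -- `Sum-shift`.
  trace-fixed {θ} E q {x} fx = ∙-cancelˡ x _ _ (begin
    x ⊹ θ (trace θ q x)                 ≈⟨ ⊹-congˡ (homo-Sum E q _) ⟩
    x ⊹ Sum q (λ e → iter θ (suc e) x)  ≈⟨ Sum-shift q (λ e → iter θ e x) ⟩
    trace θ q x ⊹ iter θ q x            ≈⟨ ⊹-congˡ fx ⟩
    trace θ q x ⊹ x                     ≈⟨ ⊹-comm _ _ ⟩
    x ⊹ trace θ q x                     ∎)

  module Descent (_≟0 : ∀ x → Dec (x ≈ 0#)) where

    -- Prime factors are dropped from an annihilator of a while the remaining product still
    -- annihilates it. The first one that cannot be dropped is p, and v is the remaining product
    -- times a.
    primeTorsion : ∀ {a} ps → All Prime ps → product ps · a ≈ 0# → ¬ a ≈ 0# →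
                   ∃ λ p → Prime p × ∃ λ v → ¬ v ≈ 0# × p · v ≈ 0#
    primeTorsion []       _          eq a≉0 = ⊥-elim (a≉0 (trans (sym (⊹-identityʳ _)) eq))
    primeTorsion {a} (p ∷ ps) (pp ∷ pps) eq a≉0 with (product ps · a) ≟0
    ... | yes eq′ = primeTorsion ps pps eq′ a≉0
    ... | no v≉0  = p , pp , product ps · a , v≉0 , trans (·-assocˡ a p (product ps)) eq

    last-nonzero : ∀ {δ} p → IsEndo δ → ∀ k {u} → iter δ k u ≈ 0# → ¬ u ≈ 0# → p · u ≈ 0# →
                   ∃ λ w → ¬ w ≈ 0# × δ w ≈ 0# × p · w ≈ 0#
    last-nonzero p E zero    eq u≉0 pu = ⊥-elim (u≉0 eq)
    last-nonzero {δ} p E (suc k) {u} eq u≉0 pu with iter δ k u ≟0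
    ... | yes eq′ = last-nonzero p E k eq′ u≉0 pu
    ... | no w≉0  = iter δ k u , w≉0 , eq , torsion (iter-isEndo E k) p pu

    -- Strip the primes off the order of ω on u. The prime p is stripped by unipotence, any other prime q
    -- by taking a trace, unless the trace vanishes. The latter must happen, as ω fixes only 0.
    coprimeAction : ∀ {ω p} → IsEndo ω → (∀ x → ω x ≈ x → x ≈ 0#) → Prime p →
      ∀ qs → All Prime qs → ∀ u → ¬ u ≈ 0# → p · u ≈ 0# → iter ω (product qs) u ≈ u →
      ∃ λ q → Prime q × q ≢ p × ∃ λ s → ∃ λ v → ¬ v ≈ 0# × p · v ≈ 0# ×
        iter (iter ω s) q v ≈ v × trace (iter ω s) q v ≈ 0#
    coprimeAction E free pp [] [] u u≉0 pu fix = ⊥-elim (u≉0 (free u fix))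
    coprimeAction {ω} {p} E free pp (q ∷ qs) (pq ∷ pqs) u u≉0 pu fix with q ℕ.≟ p
    ... | yes ≡.refl =
      let w , w≉0 , δw , pw = last-nonzero p δ-isEndo q
            (frobenius pp pu (trans (reflexive (≡.sym (iter-* ω q (product qs) u))) fix)) u≉0 pu
      in coprimeAction E free pp qs pqs w w≉0 pw (fixed-of-δ δw)
      where open Unipotent (iter-isEndo E (product qs))
    ... | no q≢p with trace (iter ω (product qs)) q u ≟0
    ...   | yes tr≈0 = q , pq , q≢p , product qs , u , u≉0 , pu , trans (reflexive (≡.sym (iter-* ω q (product qs) u))) fix , tr≈0
    ...   | no tr≉0  = coprimeAction E free pp qs pqs (trace (iter ω (product qs)) q u) tr≉0
      (torsion (trace-isEndo Eₛ q) p pu)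
      (trace-fixed Eₛ q (trans (reflexive (≡.sym (iter-* ω q (product qs) u))) fix))
      where Eₛ = iter-isEndo E (product qs)

  -- Fourier analysis over (ℤ/q)ᵐ

  module Fourier {θ : C → C} (E : IsEndo θ) {p q : ℕ} (pp : Prime p) (pq : Prime q) (q≢p : q ≢ p)
                 {v : C} (v≉0 : ¬ v ≈ 0#) (pv : p · v ≈ 0#) (fix : iter θ q v ≈ v) (tr : trace θ q v ≈ 0#) where

    -- The character sum over one factor ℤ/q, with θ in the place of a primitive q-th root of unity.
    -- `T-∣` and `T-∤` are the orthogonality relations.
    T : ℕ → C
    T d = Sum q (λ e → iter θ (e * d) v)

    T-∣ : ∀ {d} → q ∣ d → T d ≈ q · v
    T-∣ (divides-refl k) = trans (Sum-cong q λ e → trans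
        (reflexive (≡.cong (λ i → iter θ i v) (≡.sym (ℕ.*-assoc e k q)))) (iter-*-fixed E (e * k) q fix))
      (Sum-const q v)

    -- T d is fixed by θᵈ and by θ^q, hence by θ; so q · T d is its trace, which is zero.
    T-∤ : ∀ {d} → ¬ q ∣ d → T d ≈ 0#
    T-∤ {d} q∤d = coprime-kills (prime-coprime pp (distinct-primes-∤ pp pq q≢p))
        (trans (homo-Sum (·-isEndo p) q _) (trans (Sum-cong q λ e → torsion (iter-isEndo E (e * d)) p pv) (Sum-zero q)))
        qT≈0
      where
      Tθᵈ : T d ≈ trace (iter θ d) q v
      Tθᵈ = Sum-cong q λ e → reflexive (iter-* θ e d v)
      fixᵈ : iter θ d (T d) ≈ T d
      fixᵈ = trans (cong (iter-isEndo E d) Tθᵈ) (trans (trace-fixed (iter-isEndo E d) q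
        (trans (reflexive (≡.trans (≡.sym (iter-* θ q d v)) (≡.cong (λ i → iter θ i v) (ℕ.*-comm q d)))) (iter-*-fixed E d q fix))) (sym Tθᵈ))
      fixq : iter θ q (T d) ≈ T d
      fixq = trans (homo-Sum (iter-isEndo E q) q _) (Sum-cong q λ e →
        trans (iter-comm θ q (e * d) v) (cong (iter-isEndo E (e * d)) fix))
      fix₁ : θ (T d) ≈ T d
      fix₁ = fixed-by-coprime E (prime-coprime pq q∤d) fixq fixᵈ
      qT≈0 : q · T d ≈ 0#
      qT≈0 = begin
        q · T d                                              ≈⟨ Sum-const q (T d) ⟨
        Sum q (λ _ → T d)                                    ≈⟨ Sum-cong q (λ e → iter-fixed E e fix₁) ⟨
        trace θ q (T d)                                      ≈⟨ homo-Sum (trace-isEndo E q) q _ ⟩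
        Sum q (λ e → trace θ q (iter θ (e * d) v))           ≈⟨ Sum-cong q (λ e → Sum-cong q (λ e′ → iter-comm θ e′ (e * d) v)) ⟩
        Sum q (λ e → Sum q (λ e′ → iter θ (e * d) (iter θ e′ v))) ≈⟨ Sum-cong q (λ e → homo-Sum (iter-isEndo E (e * d)) q _) ⟨
        Sum q (λ e → iter θ (e * d) (trace θ q v))           ≈⟨ Sum-cong q (λ e → trans (cong (iter-isEndo E (e * d)) tr) (homo-0 (iter-isEndo E (e * d)))) ⟩
        Sum q (λ _ → 0#)                                     ≈⟨ Sum-zero q ⟩
        0#                                                   ∎

    Sumᵐ : ∀ m → (Vec ℕ m → C) → C
    Sumᵐ zero    F = F []
    Sumᵐ (suc m) F = Sum q (λ e → Sumᵐ m (λ es → F (e ∷ es)))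

    Sumᵐ-cong : ∀ m {F G} → (∀ es → F es ≈ G es) → Sumᵐ m F ≈ Sumᵐ m G
    Sumᵐ-cong zero    eq = eq []
    Sumᵐ-cong (suc m) eq = Sum-cong q λ e → Sumᵐ-cong m λ es → eq (e ∷ es)

    Sumᵐ-⊹ : ∀ m F G → Sumᵐ m (λ es → F es ⊹ G es) ≈ Sumᵐ m F ⊹ Sumᵐ m G
    Sumᵐ-⊹ zero    F G = refl
    Sumᵐ-⊹ (suc m) F G = trans (Sum-cong q λ e → Sumᵐ-⊹ m _ _) (Sum-⊹ q _ _)

    Sumᵐ-zero : ∀ m → Sumᵐ m (λ _ → 0#) ≈ 0#
    Sumᵐ-zero zero    = refl
    Sumᵐ-zero (suc m) = trans (Sum-cong q λ e → Sumᵐ-zero m) (Sum-zero q)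

    homo-Sumᵐ : ∀ {ω} → IsEndo ω → ∀ m F → ω (Sumᵐ m F) ≈ Sumᵐ m (ω ∘ F)
    homo-Sumᵐ Eω zero    F = refl
    homo-Sumᵐ Eω (suc m) F = trans (homo-Sum Eω q _) (Sum-cong q λ e → homo-Sumᵐ Eω m _)

    character : ∀ {m} → Vec ℕ m → Vec ℕ m → C
    character d e = iter θ (dot e d) v

    split : ∀ {m} d (ds : Vec ℕ m) →
            Sumᵐ (suc m) (character (d ∷ ds)) ≈ Sum q (λ e → iter θ (e * d) (Sumᵐ m (character ds)))
    split {m} d ds = Sum-cong q λ e → trans (Sumᵐ-cong m λ es → reflexive (iter-+ θ (e * d) (dot es ds) v))
      (sym (homo-Sumᵐ (iter-isEndo E (e * d)) m (character ds)))

    Sum-character-∣ : ∀ {m} {d : Vec ℕ m} → AllDivide q d → Sumᵐ m (character d) ≈ (q ^ m) · v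
    Sum-character-∣ {d = []}     []       = sym (⊹-identityʳ v)
    Sum-character-∣ {suc m} {d ∷ ds} (q∣d ∷ q∣ds) = begin
      Sumᵐ (suc m) (character (d ∷ ds))                     ≈⟨ split d ds ⟩
      Sum q (λ e → iter θ (e * d) (Sumᵐ m (character ds)))  ≈⟨ Sum-cong q (λ e → trans (cong (iter-isEndo E (e * d)) (Sum-character-∣ q∣ds)) (homo-· (iter-isEndo E (e * d)) (q ^ m) v)) ⟩
      Sum q (λ e → (q ^ m) · iter θ (e * d) v)              ≈⟨ homo-Sum (·-isEndo (q ^ m)) q _ ⟨
      (q ^ m) · T d                                         ≈⟨ ·-congʳ (q ^ m) (T-∣ q∣d) ⟩
      (q ^ m) · q · v                                       ≈⟨ ·-swap (q ^ m) q v ⟩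
      q · (q ^ m) · v                                       ≈⟨ ·-assocˡ v q (q ^ m) ⟩
      (q ^ suc m) · v                                       ∎

    Sum-character-∤ : ∀ {m} {d : Vec ℕ m} → ¬ AllDivide q d → Sumᵐ m (character d) ≈ 0#
    Sum-character-∤ {d = []} ¬all = ⊥-elim (¬all [])
    Sum-character-∤ {suc m} {d ∷ ds} ¬all with allDivide? q ds
    ... | no ¬ds = begin
      Sumᵐ (suc m) (character (d ∷ ds))                     ≈⟨ split d ds ⟩
      Sum q (λ e → iter θ (e * d) (Sumᵐ m (character ds)))  ≈⟨ Sum-cong q (λ e → trans (cong (iter-isEndo E (e * d)) (Sum-character-∤ ¬ds)) (homo-0 (iter-isEndo E (e * d)))) ⟩
      Sum q (λ _ → 0#)                                      ≈⟨ Sum-zero q ⟩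
      0#                                                    ∎
    ... | yes q∣ds = begin
      Sumᵐ (suc m) (character (d ∷ ds))                     ≈⟨ split d ds ⟩
      Sum q (λ e → iter θ (e * d) (Sumᵐ m (character ds)))  ≈⟨ Sum-cong q (λ e → trans (cong (iter-isEndo E (e * d)) (Sum-character-∣ q∣ds)) (homo-· (iter-isEndo E (e * d)) (q ^ m) v)) ⟩
      Sum q (λ e → (q ^ m) · iter θ (e * d) v)              ≈⟨ homo-Sum (·-isEndo (q ^ m)) q _ ⟨
      (q ^ m) · T d                                         ≈⟨ ·-congʳ (q ^ m) (T-∤ λ q∣d → ¬all (q∣d ∷ q∣ds)) ⟩
      (q ^ m) · 0#                                          ≈⟨ ·-zero (q ^ m) ⟩
      0#                                                    ∎

    -- The Fourier transform at frequency e of the multiset ds, seen as a function on (ℤ/q)ᵐ.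
    transform : ∀ {m} → List (Vec ℕ m) → Vec ℕ m → C
    transform []       e = 0#
    transform (d ∷ ds) e = character d e ⊹ transform ds e

    -- Twisting by θ to the power e · τ, rather than by its inverse, evaluates the inverse transform
    -- at -τ; this is why `hits` counts entries congruent to -τ. By orthogonality an entry
    -- contributes q^m v if it is such a hit and nothing otherwise.
    inversion : ∀ {m} (τ : Vec ℕ m) ds →
                Sumᵐ m (λ e → iter θ (dot e τ) (transform ds e)) ≈ hits q τ ds · (q ^ m) · v
    inversion {m} τ [] = trans (Sumᵐ-cong m λ e → homo-0 (iter-isEndo E (dot e τ))) (Sumᵐ-zero m)
    inversion {m} τ (d ∷ ds) = trans step rest
      where
      step : Sumᵐ m (λ e → iter θ (dot e τ) (transform (d ∷ ds) e)) ≈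
             Sumᵐ m (character (zipWith _+_ τ d)) ⊹ hits q τ ds · (q ^ m) · v
      step = begin
        Sumᵐ m (λ e → iter θ (dot e τ) (transform (d ∷ ds) e))
          ≈⟨ Sumᵐ-cong m (λ e → homo (iter-isEndo E (dot e τ)) _ _) ⟩
        Sumᵐ m (λ e → iter θ (dot e τ) (character d e) ⊹ iter θ (dot e τ) (transform ds e))
          ≈⟨ Sumᵐ-⊹ m _ _ ⟩
        Sumᵐ m (λ e → iter θ (dot e τ) (character d e)) ⊹ Sumᵐ m (λ e → iter θ (dot e τ) (transform ds e))
          ≈⟨ ⊹-cong (Sumᵐ-cong m λ e → reflexive (≡.trans (≡.sym (iter-+ θ (dot e τ) (dot e d) v))
               (≡.cong (λ i → iter θ i v) (≡.sym (dot-+ e τ d))))) (inversion τ ds) ⟩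
        Sumᵐ m (character (zipWith _+_ τ d)) ⊹ hits q τ ds · (q ^ m) · v ∎
      rest : Sumᵐ m (character (zipWith _+_ τ d)) ⊹ hits q τ ds · (q ^ m) · v ≈ hits q τ (d ∷ ds) · (q ^ m) · v
      rest with allDivide? q (zipWith _+_ τ d)
      ... | yes all = ⊹-congʳ (Sum-character-∣ all)
      ... | no ¬all = trans (⊹-congʳ (Sum-character-∤ ¬all)) (⊹-identityˡ _)

    -- As p does not divide q^m, the element q^m v is nonzero and killed by p, so its multiples
    -- determine the multiplier modulo p.
    hits-congruent : ∀ {m} (τ : Vec ℕ m) ds ds′ → (∀ e → transform ds e ≈ transform ds′ e) →
                     Congruent p (hits q τ ds) (hits q τ ds′)
    hits-congruent {m} τ ds ds′ eq = congruent-of-· pp pqv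
      (λ qv≈0 → v≉0 (coprime-kills (prime-coprime pp (∤-^ pp (distinct-primes-∤ pp pq q≢p) m)) pv qv≈0))
      (begin
        hits q τ ds · (q ^ m) · v                            ≈⟨ inversion τ ds ⟨
        Sumᵐ m (λ e → iter θ (dot e τ) (transform ds e))   ≈⟨ Sumᵐ-cong m (λ e → cong (iter-isEndo E (dot e τ)) (eq e)) ⟩
        Sumᵐ m (λ e → iter θ (dot e τ) (transform ds′ e))  ≈⟨ inversion τ ds′ ⟩
        hits q τ ds′ · (q ^ m) · v                           ∎)
      where
      pqv : p · (q ^ m) · v ≈ 0#
      pqv = torsion (·-isEndo (q ^ m)) p pv

    -- Otherwise θ itself fixes v, and the trace is q v, which is nonzero since q ≠ p.
    fixes-v : ∀ d → iter θ d v ≈ v → q ∣ d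
    fixes-v d fixd with q ∣? d
    ... | yes q∣d = q∣d
    ... | no q∤d = ⊥-elim (v≉0 (coprime-kills (prime-coprime pp (distinct-primes-∤ pp pq q≢p)) pv
        (trans (sym (Sum-const q v)) (trans (Sum-cong q λ e → sym (iter-fixed E e fix₁)) tr))))
      where
      fix₁ : θ v ≈ v
      fix₁ = fixed-by-coprime E (prime-coprime pq q∤d) fix fixd

    -- No inverse of θ is at hand, but on elements fixed by θ^q the iterate with exponent a (q - 1)
    -- undoes the one with exponent a.
    iter-cancel : ∀ a {x} → iter θ q x ≈ x → iter θ a v ≈ iter θ a x → v ≈ x
    iter-cancel a {x} fx eq = trans (sym (undo fix)) (trans (cong (iter-isEndo E (a * ℕ.pred q)) eq) (undo fx))
      where
      a*q : a * ℕ.pred q + a ≡ a * q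
      a*q = ≡.trans (ℕ.+-comm (a * ℕ.pred q) a) (≡.trans (≡.sym (ℕ.*-suc a (ℕ.pred q)))
        (≡.cong (a *_) (ℕ.suc-pred q {{prime⇒nonZero pq}})))
      undo : ∀ {z} → iter θ q z ≈ z → iter θ (a * ℕ.pred q) (iter θ a z) ≈ z
      undo {z} fz = trans (reflexive (≡.trans (≡.sym (iter-+ θ (a * ℕ.pred q) a z)) (≡.cong (λ i → iter θ i z) a*q)))
        (iter-*-fixed E a q fz)

    exponent-congruent : ∀ a b → iter θ a v ≈ iter θ b v → Congruent q a b
    exponent-congruent _ _ = congruent-of-≤ q (λ a b → iter θ a v ≈ iter θ b v) sym λ a d eq →
      fixes-v d (sym (iter-cancel a (trans (iter-comm θ q d v) (cong (iter-isEndo E d) fix))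
        (trans eq (reflexive (iter-+ θ a d v)))))

open ≡ using (refl; sym; trans; cong; cong₂; subst; setoid; isEquivalence; module ≡-Reasoning)

-- Deciding group identities by free reduction

module GroupSolver {A : Set} {_∙_ : Op₂ A} {ε : A} {_⁻¹ : Op₁ A} (isGroup : IsGroup _≡_ _∙_ ε _⁻¹) where
  private
    grp : Group _ _
    grp = record { isGroup = isGroup }
  open Group grp using (assoc; identityˡ; identityʳ; inverseˡ; inverseʳ)
  open GroupProperties grp

  infixl 7 _⊕_
  data Expr (n : ℕ) : Set where
    var : Fin n → Expr n
    𝟏   : Expr n
    _⊕_ : Expr n → Expr n → Expr n
    inv : Expr n → Expr n

  eval : ∀ {n} → Expr n → Vec A n → A
  eval (var i) ρ = lookup ρ i
  eval 𝟏       ρ = ε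
  eval (a ⊕ b) ρ = eval a ρ ∙ eval b ρ
  eval (inv a) ρ = (eval a ρ) ⁻¹

  signed : Bool → A → A
  signed true  x = x
  signed false x = x ⁻¹

  evalWord : ∀ {n} → List (Bool × Fin n) → Vec A n → A
  evalWord []            ρ = ε
  evalWord ((s , i) ∷ l) ρ = signed s (lookup ρ i) ∙ evalWord l ρ

  push : ∀ {n} → Bool → Fin n → List (Bool × Fin n) → List (Bool × Fin n)
  push s i [] = (s , i) ∷ []
  push s i ((t , j) ∷ l) with i Fin.≟ j | s Bool.≟ not t
  ... | yes _ | yes _ = l
  ... | _     | _     = (s , i) ∷ (t , j) ∷ l

  -- `false` asks for the inverse of the expression. The word k is what stands to its right, so each
  -- new literal can cancel only against the head of k.
  reduce : ∀ {n} → Bool → Expr n → List (Bool × Fin n) → List (Bool × Fin n)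
  reduce s     (var i) k = push s i k
  reduce s     𝟏       k = k
  reduce true  (a ⊕ b) k = reduce true a (reduce true b k)
  reduce false (a ⊕ b) k = reduce false b (reduce false a k)
  reduce s     (inv a) k = reduce (not s) a k

  signed-cancel : ∀ t x y → signed (not t) x ∙ (signed t x ∙ y) ≡ y
  signed-cancel true  x y = trans (sym (assoc _ _ _)) (trans (cong (_∙ y) (inverseˡ x)) (identityˡ y))
  signed-cancel false x y = trans (sym (assoc _ _ _)) (trans (cong (_∙ y) (inverseʳ x)) (identityˡ y))

  push-correct : ∀ {n} s (i : Fin n) l ρ → evalWord (push s i l) ρ ≡ signed s (lookup ρ i) ∙ evalWord l ρ
  push-correct s i [] ρ = refl
  push-correct s i ((t , j) ∷ l) ρ with i Fin.≟ j | s Bool.≟ not t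
  ... | yes refl | yes refl = sym (signed-cancel t (lookup ρ i) (evalWord l ρ))
  ... | yes _    | no _     = refl
  ... | no _     | yes _    = refl
  ... | no _     | no _     = refl

  signed-not : ∀ s x → signed (not s) x ≡ signed s (x ⁻¹)
  signed-not true  x = refl
  signed-not false x = sym (⁻¹-involutive x)

  reduce-correct : ∀ {n} s (e : Expr n) k ρ → evalWord (reduce s e k) ρ ≡ signed s (eval e ρ) ∙ evalWord k ρ
  reduce-correct s     (var i) k ρ = push-correct s i k ρ
  reduce-correct true  𝟏       k ρ = sym (identityˡ _)
  reduce-correct false 𝟏       k ρ = sym (trans (cong (_∙ evalWord k ρ) ε⁻¹≈ε) (identityˡ _))
  reduce-correct true  (a ⊕ b) k ρ = trans (reduce-correct true a _ ρ)
    (trans (cong (eval a ρ ∙_) (reduce-correct true b k ρ)) (sym (assoc _ _ _)))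
  reduce-correct false (a ⊕ b) k ρ = trans (reduce-correct false b _ ρ)
    (trans (cong ((eval b ρ ⁻¹) ∙_) (reduce-correct false a k ρ))
    (trans (sym (assoc _ _ _)) (cong (_∙ evalWord k ρ) (sym (⁻¹-anti-homo-∙ _ _)))))
  reduce-correct s     (inv a) k ρ = trans (reduce-correct (not s) a k ρ) (cong (_∙ evalWord k ρ) (signed-not s _))

  evalNormal : ∀ {n} → Expr n → Vec A n → A
  evalNormal e = evalWord (reduce true e [])

  open Reflection (setoid A) var eval evalNormal
    (λ e ρ → trans (reduce-correct true e [] ρ) (identityʳ _)) public using (solve; _⊜_)

-- Subsets of a finite set

module _ {n : ℕ} where

  subset : {P : Fin n → Set} → (∀ x → Dec (P x)) → Subset n
  subset P? = tabulate (λ x → does (P? x))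

  ∈-subset⁺ : {P : Fin n → Set} (P? : ∀ x → Dec (P x)) → ∀ {x} → P x → x ∈ subset P?
  ∈-subset⁺ P? {x} px = Vec.lookup⇒[]= x _ (trans (Vec.lookup∘tabulate _ x) (dec-true (P? x) px))

  ∈-subset⁻ : {P : Fin n → Set} (P? : ∀ x → Dec (P x)) → ∀ {x} → x ∈ subset P? → P x
  ∈-subset⁻ P? {x} x∈ with P? x | trans (sym (Vec.lookup∘tabulate (λ z → does (P? z)) x)) (Vec.[]=⇒lookup x∈)
  ... | yes px | _ = px

  ⊆-or-witness : (p q : Subset n) → p ⊆ q ⊎ ∃ λ x → x ∈ p × x ∉ q
  ⊆-or-witness p q with Fin.any? (λ x → (x ∈? p) ×-dec ¬? (x ∈? q))
  ... | yes w = inj₂ w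
  ... | no ¬w = inj₁ λ {x} x∈p → decidable-stable (x ∈? q) λ x∉q → ¬w (x , x∈p , x∉q)

  x∈p─q⁻ : ∀ {p q : Subset n} {x} → x ∈ p ─ q → x ∉ q
  x∈p─q⁻ {p} {q} {x} x∈ x∈q = go p q x∈ x∈q
    where
    go : ∀ {m} (p q : Subset m) {x} → x ∈ p ─ q → x ∉ q
    go (_ ∷ p) (outside ∷ q) (Vec.there x∈) (Vec.there x∈q) = go p q x∈ x∈q
    go (_ ∷ p) (inside ∷ q)  (Vec.there x∈) (Vec.there x∈q) = go p q x∈ x∈q

  -- The induction on sections H / N descends on the size of H ─ N. This covers smaller H, and
  -- `─-⊂ʳ` covers larger N.
  ─-⊂ˡ : ∀ {p q : Subset n} r → p ⊆ q → (∃ λ x → x ∈ q × x ∉ p × x ∉ r) → p ─ r ⊂ q ─ r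
  ─-⊂ˡ {p} r p⊆q (x , x∈q , x∉p , x∉r) =
    (λ y∈ → x∈p∧x∉q⇒x∈p─q (p⊆q (p─q⊆p p r y∈)) (x∈p─q⁻ {p} y∈)) ,
    x , x∈p∧x∉q⇒x∈p─q x∈q x∉r , x∉p ∘ p─q⊆p p r

  ─-⊂ʳ : ∀ p {q r : Subset n} → q ⊆ r → (∃ λ x → x ∈ p × x ∈ r × x ∉ q) → p ─ r ⊂ p ─ q
  ─-⊂ʳ p {q} {r} q⊆r (x , x∈p , x∈r , x∉q) =
    (λ y∈ → x∈p∧x∉q⇒x∈p─q (p─q⊆p p r y∈) (x∈p─q⁻ {p} y∈ ∘ q⊆r)) ,
    x , x∈p∧x∉q⇒x∈p─q x∈p x∉q , λ x∈ → x∈p─q⁻ {p} x∈ x∈r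

-- Used on all subsets of a section: either one of them yields the desired configuration, or
-- nilpotency is collected for every proper subgroup.
constant-or-all : ∀ {m} {A : Set} {B : Subset m → Set} → (∀ S → A ⊎ B S) → A ⊎ (∀ S → B S)
constant-or-all {zero} f with f []
... | inj₁ a = inj₁ a
... | inj₂ b = inj₂ λ { [] → b }
constant-or-all {suc m} f with constant-or-all (f ∘ (inside ∷_)) | constant-or-all (f ∘ (outside ∷_))
... | inj₁ a | _      = inj₁ a
... | inj₂ _ | inj₁ a = inj₁ a
... | inj₂ b | inj₂ c = inj₂ λ { (inside ∷ S) → b S ; (outside ∷ S) → c S }

-- Sections of a finite group

module FiniteGroupTheory {n : ℕ} {_∙_ : Op₂ (Fin n)} {ε : Fin n} {_⁻¹ : Op₁ (Fin n)}
                         (isGroup : IsGroup _≡_ _∙_ ε _⁻¹) where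

  private
    grp : Group _ _
    grp = record { isGroup = isGroup }
  open Group grp using (identityʳ; monoid)
  open GroupProperties grp
  open GroupSolver isGroup
  open Mult monoid using () renaming (_×_ to infixr 8 _·_; ×-homo-+ to ·-homo-+)

  conj : Fin n → Fin n → Fin n
  conj h x = (h ∙ x) ∙ (h ⁻¹)

  comm : Fin n → Fin n → Fin n
  comm x g = ((x ∙ g) ∙ (x ⁻¹)) ∙ (g ⁻¹)

  conj-ε : ∀ x → conj ε x ≡ x
  conj-ε = solve 1 (λ x → 𝟏 ⊕ x ⊕ inv 𝟏 ⊜ x) refl

  conj-∙ : ∀ h k x → conj (h ∙ k) x ≡ conj h (conj k x)
  conj-∙ = solve 3 (λ h k x → h ⊕ k ⊕ x ⊕ inv (h ⊕ k) ⊜ h ⊕ (k ⊕ x ⊕ inv k) ⊕ inv h) refl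

  conj-homo : ∀ h x y → conj h (x ∙ y) ≡ conj h x ∙ conj h y
  conj-homo = solve 3 (λ h x y → h ⊕ (x ⊕ y) ⊕ inv h ⊜ (h ⊕ x ⊕ inv h) ⊕ (h ⊕ y ⊕ inv h)) refl

  conj-⁻¹ˡ : ∀ h x → conj (h ⁻¹) (conj h x) ≡ x
  conj-⁻¹ˡ = solve 2 (λ h x → inv h ⊕ (h ⊕ x ⊕ inv h) ⊕ inv (inv h) ⊜ x) refl

  conj-⁻¹ʳ : ∀ h x → conj h (conj (h ⁻¹) x) ≡ x
  conj-⁻¹ʳ = solve 2 (λ h x → h ⊕ (inv h ⊕ x ⊕ inv (inv h)) ⊕ inv h ⊜ x) refl

  finiteOrder : ∀ x → ∃ λ k → suc k · x ≡ ε
  finiteOrder x with Fin.pigeonhole (ℕ.n<1+n n) (λ i → toℕ i · x)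
  ... | i , j , i<j , xⁱ≡xʲ = k , ∙-cancelˡ (toℕ i · x) _ _ (begin
    (toℕ i · x) ∙ (suc k · x)  ≡⟨ ·-homo-+ x (toℕ i) (suc k) ⟨
    (toℕ i + suc k) · x    ≡⟨ cong (_· x) (trans (ℕ.+-suc _ k) (proj₂ (ℕ.m≤n⇒∃[o]m+o≡n i<j))) ⟩
    toℕ j · x              ≡⟨ xⁱ≡xʲ ⟨
    toℕ i · x              ≡⟨ identityʳ _ ⟨
    (toℕ i · x) ∙ ε          ∎)
    where
    open ≡-Reasoning
    k = proj₁ (ℕ.m≤n⇒∃[o]m+o≡n i<j)

  IsSubgroup : Subset n → Set
  IsSubgroup H = ε ∈ H × (∀ x y → x ∈ H → y ∈ H → x ∙ y ∈ H)

  isSubgroup? : ∀ H → Dec (IsSubgroup H)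
  isSubgroup? H = (ε ∈? H) ×-dec
    Fin.all? λ x → Fin.all? λ y → (x ∈? H) →-dec ((y ∈? H) →-dec ((x ∙ y) ∈? H))

  -- Finiteness supplies the inverses.
  ⁻¹-closed : ∀ {H} → IsSubgroup H → ∀ {x} → x ∈ H → x ⁻¹ ∈ H
  ⁻¹-closed {H} (ε∈ , ∙∈) {x} x∈ = subst (_∈ H) (inverseʳ-unique x (k · x) xᵏ⁺¹≡ε) (pow∈ k)
    where
    k = proj₁ (finiteOrder x)
    xᵏ⁺¹≡ε = proj₂ (finiteOrder x)
    pow∈ : ∀ i → i · x ∈ H
    pow∈ zero    = ε∈
    pow∈ (suc i) = ∙∈ _ _ x∈ (pow∈ i)

  conj-closed : ∀ {H} → IsSubgroup H → ∀ {h x} → h ∈ H → x ∈ H → conj h x ∈ H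
  conj-closed sH h∈ x∈ = proj₂ sH _ _ (proj₂ sH _ _ h∈ x∈) (⁻¹-closed sH h∈)

  comm-closed : ∀ {H} → IsSubgroup H → ∀ {x g} → x ∈ H → g ∈ H → comm x g ∈ H
  comm-closed sH x∈ g∈ = proj₂ sH _ _ (conj-closed sH x∈ g∈) (⁻¹-closed sH g∈)

  ∩-isSubgroup : ∀ {H K} → IsSubgroup H → IsSubgroup K → IsSubgroup (H ∩ K)
  ∩-isSubgroup {H} {K} (eH , mH) (eK , mK) = x∈p∩q⁺ (eH , eK) , λ x y x∈ y∈ →
    let xH , xK = x∈p∩q⁻ H K x∈ ; yH , yK = x∈p∩q⁻ H K y∈ in x∈p∩q⁺ (mH x y xH yH , mK x y xK yK)

  Normalizes : Subset n → Subset n → Set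
  Normalizes H N = ∀ h x → h ∈ H → x ∈ N → conj h x ∈ N

  infix 4 _⊴_
  _⊴_ : Subset n → Subset n → Set
  N ⊴ H = IsSubgroup N × N ⊆ H × Normalizes H N

  _⊴?_ : ∀ N H → Dec (N ⊴ H)
  N ⊴? H = isSubgroup? N ×-dec (N ⊆? H) ×-dec
    Fin.all? λ h → Fin.all? λ x → (h ∈? H) →-dec ((x ∈? N) →-dec (conj h x ∈? N))

  -- The upper central series of H / N.
  Zᵣ : Subset n → Subset n → ℕ → Fin n → Set
  Zᵣ H N zero    x = x ∈ N
  Zᵣ H N (suc c) x = ∀ g → g ∈ H → Zᵣ H N c (comm x g)

  Nil : Subset n → Subset n → Set
  Nil H N = ∃ λ c → ∀ x → x ∈ H → Zᵣ H N c x

  commutesModulo? : ∀ H N x → Dec (∀ g → g ∈ H → comm x g ∈ N)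
  commutesModulo? H N x = Fin.all? λ g → (g ∈? H) →-dec (comm x g ∈? N)

  centre? : ∀ H N x → Dec (x ∈ H × (∀ g → g ∈ H → comm x g ∈ N))
  centre? H N x = (x ∈? H) ×-dec commutesModulo? H N x

  centre : Subset n → Subset n → Subset n
  centre H N = subset (centre? H N)

  centre-nil : ∀ {H N} → Nil H (centre H N) → Nil H N
  centre-nil {H} {N} (c , f) = suc c , λ x x∈ → lift c x (f x x∈)
    where
    lift : ∀ c x → Zᵣ H (centre H N) c x → Zᵣ H N (suc c) x
    lift zero    x z = proj₂ (∈-subset⁻ (centre? H N) z)
    lift (suc c) x z g g∈ = lift c (comm x g) (z g g∈)

  module _ {H N} (sH : IsSubgroup H) (N⊴H : N ⊴ H) where
    private
      sN = proj₁ N⊴H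
      N⊆H = proj₁ (proj₂ N⊴H)
      conjN = proj₂ (proj₂ N⊴H)

    ⊆-centre : N ⊆ centre H N
    ⊆-centre {x} x∈ = ∈-subset⁺ (centre? H N) (N⊆H x∈ , λ g g∈ →
      subst (_∈ N) (solve 2 (λ x g → x ⊕ (g ⊕ inv x ⊕ inv g) ⊜ x ⊕ g ⊕ inv x ⊕ inv g) refl x g)
        (proj₂ sN _ _ x∈ (conjN g _ g∈ (⁻¹-closed sN x∈))))

    centre-⊴ : centre H N ⊴ H
    centre-⊴ = (ε∈ , ∙∈) , (λ x∈ → proj₁ (∈-subset⁻ (centre? H N) x∈)) , normal
      where
      ε∈ : ε ∈ centre H N
      ε∈ = ∈-subset⁺ (centre? H N) (proj₁ sH , λ g _ →
        subst (_∈ N) (solve 1 (λ g → 𝟏 ⊜ 𝟏 ⊕ g ⊕ inv 𝟏 ⊕ inv g) refl g) (proj₁ sN))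
      ∙∈ : ∀ x y → x ∈ centre H N → y ∈ centre H N → x ∙ y ∈ centre H N
      ∙∈ x y x∈ y∈ with ∈-subset⁻ (centre? H N) x∈ | ∈-subset⁻ (centre? H N) y∈
      ... | xH , cx | yH , cy = ∈-subset⁺ (centre? H N) (proj₂ sH _ _ xH yH , λ g g∈ →
        subst (_∈ N) (solve 3 (λ x y g → x ⊕ (y ⊕ g ⊕ inv y ⊕ inv g) ⊕ inv x ⊕ (x ⊕ g ⊕ inv x ⊕ inv g)
                                         ⊜ x ⊕ y ⊕ g ⊕ inv (x ⊕ y) ⊕ inv g) refl x y g)
          (proj₂ sN _ _ (conjN x _ xH (cy g g∈)) (cx g g∈)))
      normal : Normalizes H (centre H N)
      normal h x h∈ x∈ with ∈-subset⁻ (centre? H N) x∈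
      ... | xH , cx = ∈-subset⁺ (centre? H N) (conj-closed sH h∈ xH , λ g g∈ →
        subst (_∈ N) (solve 3 (λ h x g → let g′ = inv h ⊕ g ⊕ inv (inv h) in
                                h ⊕ (x ⊕ g′ ⊕ inv x ⊕ inv g′) ⊕ inv h
                                ⊜ (h ⊕ x ⊕ inv h) ⊕ g ⊕ inv (h ⊕ x ⊕ inv h) ⊕ inv g) refl h x g)
          (conjN h _ h∈ (cx _ (conj-closed sH (⁻¹-closed sH h∈) g∈))))

    centralizer? : ∀ a g → Dec (g ∈ H × comm a g ∈ N)
    centralizer? a g = (g ∈? H) ×-dec (comm a g ∈? N)

    centralizer : Fin n → Subset n
    centralizer a = subset (centralizer? a)

    centralizer-isSubgroup : ∀ a → IsSubgroup (centralizer a)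
    centralizer-isSubgroup a = ∈-subset⁺ (centralizer? a) (proj₁ sH ,
        subst (_∈ N) (solve 1 (λ a → 𝟏 ⊜ a ⊕ 𝟏 ⊕ inv a ⊕ inv 𝟏) refl a) (proj₁ sN)) , ∙∈
      where
      ∙∈ : ∀ x y → x ∈ centralizer a → y ∈ centralizer a → x ∙ y ∈ centralizer a
      ∙∈ x y x∈ y∈ with ∈-subset⁻ (centralizer? a) x∈ | ∈-subset⁻ (centralizer? a) y∈
      ... | xH , cx | yH , cy = ∈-subset⁺ (centralizer? a) (proj₂ sH _ _ xH yH ,
        subst (_∈ N) (solve 3 (λ a x y → (a ⊕ x ⊕ inv a ⊕ inv x) ⊕ (x ⊕ (a ⊕ y ⊕ inv a ⊕ inv y) ⊕ inv x)
                                         ⊜ a ⊕ (x ⊕ y) ⊕ inv a ⊕ inv (x ⊕ y)) refl a x y)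
          (proj₂ sN _ _ cx (conjN x _ xH cy)))

    ⊆-centralizer : ∀ {a} → a ∈ H → N ⊆ centralizer a
    ⊆-centralizer {a} a∈ {x} x∈ = ∈-subset⁺ (centralizer? a) (N⊆H x∈ ,
      proj₂ sN _ _ (conjN a x a∈ x∈) (⁻¹-closed sN x∈))

    ∈-centralizer : ∀ {a} → a ∈ H → a ∈ centralizer a
    ∈-centralizer {a} a∈ = ∈-subset⁺ (centralizer? a) (a∈ ,
      subst (_∈ N) (solve 1 (λ a → 𝟏 ⊜ a ⊕ a ⊕ inv a ⊕ inv a) refl a) (proj₁ sN))

  normalizer? : ∀ H D h → Dec (h ∈ H × (∀ d → d ∈ D → conj h d ∈ D))
  normalizer? H D h = (h ∈? H) ×-dec Fin.all? λ d → (d ∈? D) →-dec (conj h d ∈? D)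

  normalizer : Subset n → Subset n → Subset n
  normalizer H D = subset (normalizer? H D)

  normalizer-isSubgroup : ∀ {H} D → IsSubgroup H → IsSubgroup (normalizer H D)
  normalizer-isSubgroup {H} D sH = ∈-subset⁺ (normalizer? H D) (proj₁ sH , λ d d∈ → subst (_∈ D) (sym (conj-ε d)) d∈) ,
    λ x y x∈ y∈ → let xH , nx = ∈-subset⁻ (normalizer? H D) x∈ ; yH , ny = ∈-subset⁻ (normalizer? H D) y∈ in
      ∈-subset⁺ (normalizer? H D) (proj₂ sH _ _ xH yH , λ d d∈ → subst (_∈ D) (sym (conj-∙ x y d)) (nx _ (ny d d∈)))

  ⊆-normalizer : ∀ {H D} → IsSubgroup D → D ⊆ H → D ⊆ normalizer H D
  ⊆-normalizer {H} {D} sD D⊆H x∈ = ∈-subset⁺ (normalizer? H D) (D⊆H x∈ , λ d d∈ → conj-closed sD x∈ d∈)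

  -- Take commutators of an element outside D with elements of D until it normalizes D; the upper central
  -- series bounds the number of steps.
  normalizer-grows : ∀ {K N D} → IsSubgroup K → Nil K N → IsSubgroup D → N ⊆ D → D ⊆ K →
                     (∃ λ u → u ∈ K × u ∉ D) → ∃ λ z → z ∈ K × z ∉ D × (∀ d → d ∈ D → conj z d ∈ D)
  normalizer-grows {K} {N} {D} sK (c , nil) sD N⊆D D⊆K (u , u∈ , u∉) = go c u u∈ u∉ (nil u u∈)
    where
    go : ∀ c u → u ∈ K → u ∉ D → Zᵣ K N c u → ∃ λ z → z ∈ K × z ∉ D × (∀ d → d ∈ D → conj z d ∈ D)
    go zero    u u∈ u∉ z = ⊥-elim (u∉ (N⊆D z))
    go (suc c) u u∈ u∉ z with Fin.any? (λ d → (d ∈? D) ×-dec ¬? (comm u d ∈? D))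
    ... | yes (d , d∈ , w) = go c (comm u d) (comm-closed sK u∈ (D⊆K d∈)) w (z d (D⊆K d∈))
    ... | no ¬w = u , u∈ , u∉ , λ d d∈ →
      subst (_∈ D) (solve 2 (λ u d → u ⊕ d ⊕ inv u ⊕ inv d ⊕ d ⊜ u ⊕ d ⊕ inv u) refl u d)
        (proj₂ sD _ _ (decidable-stable (comm u d ∈? D) λ c∉ → ¬w (d , d∈ , c∉)) d∈)

  -- The descent of `normalizer-grows` again: pass from u to a commutator outside N as long as there
  -- is one, at most c times; where this stops, the element is central modulo N.
  centre-nontrivial : ∀ {H N} → IsSubgroup H → Nil H N → (∃ λ u → u ∈ H × u ∉ N) →
                      ∃ λ z → z ∈ centre H N × z ∉ N
  centre-nontrivial {H} {N} sH (c , nil) (u , u∈ , u∉) = go c u u∈ u∉ (nil u u∈)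
    where
    go : ∀ c u → u ∈ H → u ∉ N → Zᵣ H N c u → ∃ λ z → z ∈ centre H N × z ∉ N
    go zero    u u∈ u∉ z = ⊥-elim (u∉ z)
    go (suc c) u u∈ u∉ z with Fin.any? (λ g → (g ∈? H) ×-dec ¬? (comm u g ∈? N))
    ... | yes (g , g∈ , w) = go c (comm u g) (comm-closed sH u∈ g∈) w (z g g∈)
    ... | no ¬w = u , ∈-subset⁺ (centre? H N) (u∈ , λ g g∈ →
      decidable-stable (comm u g ∈? N) λ c∉ → ¬w (g , g∈ , c∉)) , u∉

  IsMaximal : Subset n → Subset n → Set
  IsMaximal H M = IsSubgroup M × M ⊂ H × (∀ L → IsSubgroup L → M ⊆ L → L ⊂ H → L ⊆ M)

  extendToMaximal : ∀ {H} L → IsSubgroup L → L ⊂ H → ∃ λ M → L ⊆ M × IsMaximal H M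
  extendToMaximal {H} L = go L (<-wellFounded _)
    where
    go : ∀ L → Acc _<_ ∣ H ─ L ∣ → IsSubgroup L → L ⊂ H → ∃ λ M → L ⊆ M × IsMaximal H M
    go L (acc rs) sL L⊂H with anySubset? (λ L′ → isSubgroup? L′ ×-dec (L ⊂? L′) ×-dec (L′ ⊂? H))
    ... | yes (L′ , sL′ , (L⊆L′ , x , x∈ , x∉) , L′⊂H@(L′⊆H , _)) =
      let M , L′⊆M , max = go L′ (rs (p⊂q⇒∣p∣<∣q∣ (─-⊂ʳ H L⊆L′ (x , L′⊆H x∈ , x∈ , x∉)))) sL′ L′⊂H
      in M , (L′⊆M ∘ L⊆L′) , max
    ... | no ¬L′ = L , id , sL , L⊂H , λ L′ sL′ L⊆L′ L′⊂H → case-⊆ L′ sL′ L⊆L′ L′⊂H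
      where
      case-⊆ : ∀ L′ → IsSubgroup L′ → L ⊆ L′ → L′ ⊂ H → L′ ⊆ L
      case-⊆ L′ sL′ L⊆L′ L′⊂H with ⊆-or-witness L′ L
      ... | inj₁ L′⊆L = L′⊆L
      ... | inj₂ w = ⊥-elim (¬L′ (L′ , sL′ , (L⊆L′ , w) , L′⊂H))

  maximal-all : ∀ {H M L} → IsMaximal H M → IsSubgroup L → M ⊆ L → L ⊆ H → (∃ λ x → x ∈ L × x ∉ M) → H ⊆ L
  maximal-all {H} {M} {L} (_ , _ , max) sL M⊆L L⊆H (x , x∈ , x∉) with ⊆-or-witness H L
  ... | inj₁ H⊆L = H⊆L
  ... | inj₂ w = ⊥-elim (x∉ (max L sL M⊆L (L⊆H , w) x∈))

  -- Conjugation by y is a fixed-point-free automorphism of the nontrivial abelian section A / N.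
  record FixedPointFree : Set where
    field
      N A    : Subset n
      y a₀   : Fin n
      sub-N  : IsSubgroup N
      sub-A  : IsSubgroup A
      A-N    : Normalizes A N
      y-N    : ∀ x → x ∈ N → conj y x ∈ N
      y-A    : ∀ x → x ∈ A → conj y x ∈ A
      abel   : ∀ a b → a ∈ A → b ∈ A → comm a b ∈ N
      free   : ∀ a → a ∈ A → comm y a ∈ N → a ∈ N
      a₀∈A   : a₀ ∈ A
      a₀∉N   : a₀ ∉ N

-- Counting

module Counting {n : ℕ} where
  open SemiringSum ℕ.+-*-semiring public using (sum; sum-cong-≗; ∑-comm; *-distribˡ-sum; *-distribʳ-sum; ∑-distrib-+; sum-permute)

  𝟙 : {P : Set} → Dec P → ℕ
  𝟙 (yes _) = 1
  𝟙 (no _)  = 0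

  𝟙-mono : {P Q : Set} (P? : Dec P) (Q? : Dec Q) → (P → Q) → 𝟙 P? ≤ 𝟙 Q?
  𝟙-mono (no _)  _       _ = z≤n
  𝟙-mono (yes p) (yes q) _ = ℕ.≤-refl
  𝟙-mono (yes p) (no ¬q) f = ⊥-elim (¬q (f p))

  𝟙-cong : {P Q : Set} (P? : Dec P) (Q? : Dec Q) → (P → Q) → (Q → P) → 𝟙 P? ≡ 𝟙 Q?
  𝟙-cong P? Q? f g = ℕ.≤-antisym (𝟙-mono P? Q? f) (𝟙-mono Q? P? g)

  𝟙-no : {P : Set} (P? : Dec P) → ¬ P → 𝟙 P? ≡ 0
  𝟙-no (yes p) ¬p = ⊥-elim (¬p p)
  𝟙-no (no _)  _  = refl

  𝟙-yes : {P : Set} (P? : Dec P) → P → 𝟙 P? ≡ 1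
  𝟙-yes (yes _) _ = refl
  𝟙-yes (no ¬p) p = ⊥-elim (¬p p)

  𝟙-× : {P Q : Set} (P? : Dec P) (Q? : Dec Q) → 𝟙 (P? ×-dec Q?) ≡ 𝟙 P? * 𝟙 Q?
  𝟙-× (yes _) (yes _) = refl
  𝟙-× (yes _) (no _)  = refl
  𝟙-× (no _)  (yes _) = refl
  𝟙-× (no _)  (no _)  = refl

  sum-mono : ∀ {m} {f g : Fin m → ℕ} → (∀ i → f i ≤ g i) → sum f ≤ sum g
  sum-mono {zero}  f≤g = z≤n
  sum-mono {suc m} f≤g = ℕ.+-mono-≤ (f≤g zero) (sum-mono (f≤g ∘ suc))

  sum-0 : ∀ {m} {f : Fin m → ℕ} → (∀ i → f i ≡ 0) → sum f ≡ 0
  sum-0 {zero}  f≡0 = refl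
  sum-0 {suc m} f≡0 = cong₂ _+_ (f≡0 zero) (sum-0 (f≡0 ∘ suc))

  sum-≥1 : ∀ {m} {f : Fin m → ℕ} i → 1 ≤ f i → 1 ≤ sum f
  sum-≥1 zero    le = ℕ.≤-trans le (ℕ.m≤m+n _ _)
  sum-≥1 (suc i) le = ℕ.≤-trans (sum-≥1 i le) (ℕ.m≤n+m _ _)

  sum-reindex : (f : Fin n → ℕ) (g h : Fin n → Fin n) → (∀ x → g (h x) ≡ x) → (∀ x → h (g x) ≡ x) → sum (f ∘ g) ≡ sum f
  sum-reindex f g h gh hg = sym (sum-permute f (permutation g h gh hg))

  count : {P : Fin n → Set} → (∀ x → Dec (P x)) → ℕ
  count P? = sum (λ x → 𝟙 (P? x))

  count-mono : {P Q : Fin n → Set} (P? : ∀ x → Dec (P x)) (Q? : ∀ x → Dec (Q x)) →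
               (∀ x → P x → Q x) → count P? ≤ count Q?
  count-mono P? Q? f = sum-mono λ x → 𝟙-mono (P? x) (Q? x) (f x)

  count-+ : {P Q : Fin n → Set} (P? : ∀ x → Dec (P x)) (Q? : ∀ x → Dec (Q x)) {R : Fin n → Set} (R? : ∀ x → Dec (R x)) →
            (∀ x → P x → R x) → (∀ x → Q x → R x) → (∀ x → P x → Q x → ⊥) → count P? + count Q? ≤ count R?
  count-+ P? Q? R? p q dis = ℕ.≤-trans (ℕ.≤-reflexive (sym (∑-distrib-+ (λ x → 𝟙 (P? x)) (λ x → 𝟙 (Q? x)))))
    (sum-mono λ x → lem (P? x) (Q? x) (R? x) (p x) (q x) (dis x))
    where
    lem : {P Q R : Set} (P? : Dec P) (Q? : Dec Q) (R? : Dec R) → (P → R) → (Q → R) → (P → Q → ⊥) → 𝟙 P? + 𝟙 Q? ≤ 𝟙 R?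
    lem (yes p) (yes q) _  _ _ dis = ⊥-elim (dis p q)
    lem (yes p) (no _)  R? f _ _   = 𝟙-mono (yes p) R? f
    lem (no _)  Q?      R? _ g _   = 𝟙-mono Q? R? g

  count-cover : {P Q : Fin n → Set} (P? : ∀ x → Dec (P x)) (Q? : ∀ x → Dec (Q x)) {R : Fin n → Set} (R? : ∀ x → Dec (R x)) →
                (∀ x → R x → P x ⊎ Q x) → count R? ≤ count P? + count Q?
  count-cover P? Q? R? r = ℕ.≤-trans (sum-mono λ x → lem (P? x) (Q? x) (R? x) (r x))
    (ℕ.≤-reflexive (∑-distrib-+ (λ x → 𝟙 (P? x)) (λ x → 𝟙 (Q? x))))
    where
    lem : {P Q R : Set} (P? : Dec P) (Q? : Dec Q) (R? : Dec R) → (R → P ⊎ Q) → 𝟙 R? ≤ 𝟙 P? + 𝟙 Q?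
    lem P?      Q?      (no _)  _ = z≤n
    lem (yes _) Q?      (yes _) _ = s≤s z≤n
    lem (no _)  (yes _) (yes _) _ = s≤s z≤n
    lem (no ¬p) (no ¬q) (yes r) f with f r
    ... | inj₁ p = ⊥-elim (¬p p)
    ... | inj₂ q = ⊥-elim (¬q q)

-- Minimal nonnilpotent sections

module Sections {n : ℕ} {_∙_ : Op₂ (Fin n)} {ε : Fin n} {_⁻¹ : Op₁ (Fin n)}
                (isGroup : IsGroup _≡_ _∙_ ε _⁻¹) where
  open GroupSolver isGroup
  open FiniteGroupTheory isGroup
  open Counting {n}

  module CentrelessSection {H N : Subset n} (sH : IsSubgroup H) (N⊴H : N ⊴ H)
    (subgroups-nil : ∀ S → IsSubgroup S → N ⊆ S → S ⊂ H → Nil S N)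
    (centreless : ∀ x → x ∈ H → (∀ g → g ∈ H → comm x g ∈ N) → x ∈ N) where
    private
      sN = proj₁ N⊴H
      N⊆H = proj₁ (proj₂ N⊴H)
      conjN = proj₂ (proj₂ N⊴H)

    -- A maximal subgroup M above N′ is normal because H / N′ is nilpotent; an element of the
    -- centre of M / N fixed by some y outside M would be central in H / N.
    nilpotentQuotient : ∀ N′ → IsSubgroup N′ → N ⊂ N′ → N′ ⊂ H → Nil H N′ → FixedPointFree
    nilpotentQuotient N′ sN′ (N⊆N′ , u , u∈N′ , u∉N) N′⊂H nilQ
      with extendToMaximal N′ sN′ N′⊂H
    ... | M , N′⊆M , max@(sM , (M⊆H , w) , _)
      with normalizer-grows sH nilQ sM N′⊆M M⊆H w
         | centre-nontrivial sM (subgroups-nil M sM (N′⊆M ∘ N⊆N′) (M⊆H , w)) (u , N′⊆M u∈N′ , u∉N)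
    ... | y , y∈ , y∉ , y-M | a₀ , a₀∈A , a₀∉N = record
      { N = N ; A = A ; y = y ; a₀ = a₀ ; sub-N = sN ; sub-A = proj₁ A⊴M
      ; A-N = λ h x h∈ → conjN h x (M⊆H (proj₁ (proj₂ A⊴M) h∈))
      ; y-N = λ x → conjN y x y∈ ; y-A = y-A
      ; abel = λ a b a∈ b∈ → proj₂ (∈-subset⁻ (centre? M N) a∈) b (proj₁ (proj₂ A⊴M) b∈)
      ; free = free ; a₀∈A = a₀∈A ; a₀∉N = a₀∉N }
      where
      N⊴M : N ⊴ M
      N⊴M = sN , (N′⊆M ∘ N⊆N′) , λ h x h∈ → conjN h x (M⊆H h∈)
      A = centre M N
      A⊴M : A ⊴ M
      A⊴M = centre-⊴ sM N⊴M
      H⊆NM : H ⊆ normalizer H M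
      H⊆NM = maximal-all max (normalizer-isSubgroup M sH) (⊆-normalizer sM M⊆H)
        (λ x∈ → proj₁ (∈-subset⁻ (normalizer? H M) x∈)) (y , ∈-subset⁺ (normalizer? H M) (y∈ , y-M) , y∉)
      y-A : ∀ x → x ∈ A → conj y x ∈ A
      y-A x x∈ with ∈-subset⁻ (centre? M N) x∈
      ... | xM , cx = ∈-subset⁺ (centre? M N) (y-M x xM , λ g g∈ →
        subst (_∈ N) (solve 3 (λ h x g → let g′ = inv h ⊕ g ⊕ inv (inv h) in
                                h ⊕ (x ⊕ g′ ⊕ inv x ⊕ inv g′) ⊕ inv h
                                ⊜ (h ⊕ x ⊕ inv h) ⊕ g ⊕ inv (h ⊕ x ⊕ inv h) ⊕ inv g) refl y x g)
          (conjN y _ y∈ (cx _ (proj₂ (∈-subset⁻ (normalizer? H M) (H⊆NM (⁻¹-closed sH y∈))) g g∈))))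
      free : ∀ a → a ∈ A → comm y a ∈ N → a ∈ N
      free a a∈ ya∈ with ∈-subset⁻ (centre? M N) a∈
      ... | aM , ca = centreless a (M⊆H aM) λ g g∈ → proj₂ (∈-subset⁻ (centralizer? sH N⊴H a) (H⊆C g∈))
        where
        C = centralizer sH N⊴H a
        H⊆C : H ⊆ C
        H⊆C = maximal-all max (centralizer-isSubgroup sH N⊴H a)
          (λ x∈ → ∈-subset⁺ (centralizer? sH N⊴H a) (M⊆H x∈ , ca _ x∈))
          (λ x∈ → proj₁ (∈-subset⁻ (centralizer? sH N⊴H a) x∈))
          (y , ∈-subset⁺ (centralizer? sH N⊴H a) (y∈ ,
            subst (_∈ N) (solve 2 (λ y a → inv (y ⊕ a ⊕ inv y ⊕ inv a) ⊜ a ⊕ y ⊕ inv a ⊕ inv y) refl y a)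
              (⁻¹-closed sN ya∈)) , y∉)

    module Simple (simple : ∀ S → S ⊴ H → N ⊂ S → S ⊂ H → ⊥) where

      Max : Subset n → Set
      Max M = N ⊆ M × IsMaximal H M

      -- Schmidt: distinct maximal subgroups meet in N. If they met in a larger D, the normalizer of D
      -- would be contained in a maximal subgroup whose intersections with both are larger than D.
      maximal-disjoint : ∀ M₁ M₂ → Max M₁ → Max M₂ → (∃ λ x → x ∈ M₁ × x ∈ M₂ × x ∉ N) → M₁ ⊆ M₂
      maximal-disjoint M₁ M₂ = go M₁ M₂ (<-wellFounded _)
        where
        go : ∀ M₁ M₂ → Acc _<_ ∣ H ─ (M₁ ∩ M₂) ∣ → Max M₁ → Max M₂ →
             (∃ λ x → x ∈ M₁ × x ∈ M₂ × x ∉ N) → M₁ ⊆ M₂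
        go M₁ M₂ (acc rs) mx₁@(N⊆M₁ , s₁ , M₁⊂H , max₁) mx₂@(N⊆M₂ , s₂ , M₂⊂H , max₂) (x , x∈₁ , x∈₂ , x∉N)
          with ⊆-or-witness M₁ M₂ | ⊆-or-witness M₂ M₁
        ... | inj₁ M₁⊆M₂ | _          = M₁⊆M₂
        ... | inj₂ _     | inj₁ M₂⊆M₁ = max₂ M₁ s₁ M₂⊆M₁ M₁⊂H
        ... | inj₂ (u , u∈₁ , u∉₂) | inj₂ (v , v∈₂ , v∉₁) =
          -- Both subgroups lie in the proper subgroup C. Maximality of M₁ gives C ⊆ M₁, hence M₂ ⊆
          -- M₁, and maximality of M₂ reverses this inclusion.
          max₂ M₁ s₁ (max₁ C sC M₁⊆C C⊂H ∘ M₂⊆C) M₁⊂H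
          where
          D = M₁ ∩ M₂
          D⊆₁ : D ⊆ M₁
          D⊆₁ = p∩q⊆p M₁ M₂
          D⊆₂ : D ⊆ M₂
          D⊆₂ = p∩q⊆q M₁ M₂
          sD : IsSubgroup D
          sD = ∩-isSubgroup s₁ s₂
          N⊆D : N ⊆ D
          N⊆D z∈ = x∈p∩q⁺ (N⊆M₁ z∈ , N⊆M₂ z∈)
          D⊆H : D ⊆ H
          D⊆H = proj₁ M₁⊂H ∘ D⊆₁
          D⊂H : D ⊂ H
          D⊂H = D⊆H , u , proj₁ M₁⊂H u∈₁ , u∉₂ ∘ D⊆₂
          L = normalizer H D
          L⊂H : L ⊂ H
          L⊂H with ⊆-or-witness H L
          ... | inj₁ H⊆L = ⊥-elim (simple D
            (sD , D⊆H , λ h d h∈ d∈ → proj₂ (∈-subset⁻ (normalizer? H D) (H⊆L h∈)) d d∈)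
            (N⊆D , x , x∈p∩q⁺ (x∈₁ , x∈₂) , x∉N) D⊂H)
          ... | inj₂ w = (λ z∈ → proj₁ (∈-subset⁻ (normalizer? H D) z∈)) , w
          ext = extendToMaximal L (normalizer-isSubgroup D sH) L⊂H
          C = proj₁ ext
          L⊆C : L ⊆ C
          L⊆C = proj₁ (proj₂ ext)
          maxC = proj₂ (proj₂ ext)
          sC = proj₁ maxC
          C⊂H = proj₁ (proj₂ maxC)
          D⊆C : D ⊆ C
          D⊆C = L⊆C ∘ ⊆-normalizer sD D⊆H
          mxC : Max C
          mxC = (D⊆C ∘ N⊆D) , maxC
          -- M is nilpotent modulo N, so some z in M outside D normalizes D. It lies in L ⊆ C, hence
          -- M ∩ C exceeds D and the induction hypothesis applies to M and C.
          grow : ∀ M → Max M → D ⊆ M → (∃ λ u → u ∈ M × u ∉ D) → M ⊆ C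
          grow M mx@(N⊆M , sM , M⊂H , _) D⊆M w
            with normalizer-grows sM (subgroups-nil M sM N⊆M M⊂H) sD N⊆D D⊆M w
          ... | z , z∈M , z∉D , z-D = go M C
              (rs (p⊂q⇒∣p∣<∣q∣ (─-⊂ʳ H {D} {M ∩ C} (λ d∈ → x∈p∩q⁺ (D⊆M d∈ , D⊆C d∈))
                (z , proj₁ M⊂H z∈M , x∈p∩q⁺ (z∈M , z∈C) , z∉D))))
              mx mxC (x , D⊆M x∈D , D⊆C x∈D , x∉N)
            where
            x∈D = x∈p∩q⁺ (x∈₁ , x∈₂)
            z∈C : z ∈ C
            z∈C = L⊆C (∈-subset⁺ (normalizer? H D) (proj₁ M⊂H z∈M , z-D))
          M₁⊆C : M₁ ⊆ C
          M₁⊆C = grow M₁ mx₁ D⊆₁ (u , u∈₁ , u∉₂ ∘ D⊆₂)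
          M₂⊆C : M₂ ⊆ C
          M₂⊆C = grow M₂ mx₂ D⊆₂ (v , v∈₂ , v∉₁ ∘ D⊆₁)

      -- The centralizer of x modulo N contains x and is proper because the section has trivial
      -- centre.
      maximal-containing : ∀ x → x ∈ H → x ∉ N → ∃ λ M → Max M × x ∈ M
      maximal-containing x x∈ x∉ with ⊆-or-witness H (centralizer sH N⊴H x)
      ... | inj₁ H⊆C = ⊥-elim (x∉ (centreless x x∈ λ g g∈ → proj₂ (∈-subset⁻ (centralizer? sH N⊴H x) (H⊆C g∈))))
      ... | inj₂ w =
        let M , C⊆M , max = extendToMaximal (centralizer sH N⊴H x) (centralizer-isSubgroup sH N⊴H x)
                              ((λ z∈ → proj₁ (∈-subset⁻ (centralizer? sH N⊴H x) z∈)) , w)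
        in M , ((C⊆M ∘ ⊆-centralizer sH N⊴H x∈) , max) , C⊆M (∈-centralizer sH N⊴H x∈)

      -- By simplicity M is not normal, so its normalizer is a proper subgroup above M and
      -- maximality collapses it to M.
      self-normalizing : ∀ {M x} → Max M → x ∈ M → x ∉ N → ∀ h → h ∈ H → (∀ m → m ∈ M → conj h m ∈ M) → h ∈ M
      self-normalizing {M} {x} (N⊆M , sM , M⊂H , max) x∈ x∉ h h∈ h-M with ⊆-or-witness H (normalizer H M)
      ... | inj₁ H⊆L = ⊥-elim (simple M (sM , proj₁ M⊂H , λ g m g∈ m∈ → proj₂ (∈-subset⁻ (normalizer? H M) (H⊆L g∈)) m m∈)
                                (N⊆M , x , x∈ , x∉) M⊂H)
      ... | inj₂ w = max (normalizer H M) (normalizer-isSubgroup M sH) (⊆-normalizer sM (proj₁ M⊂H))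
                       ((λ z∈ → proj₁ (∈-subset⁻ (normalizer? H M) z∈)) , w) (∈-subset⁺ (normalizer? H M) (h∈ , h-M))

      conjugate? : ∀ h M x → Dec (conj (h ⁻¹) x ∈ M)
      conjugate? h M x = conj (h ⁻¹) x ∈? M

      conjugate : Fin n → Subset n → Subset n
      conjugate h M = subset (conjugate? h M)

      conjugate-isSubgroup : ∀ h {M} → IsSubgroup M → IsSubgroup (conjugate h M)
      conjugate-isSubgroup h {M} (ε∈ , ∙∈) =
        ∈-subset⁺ (conjugate? h M) (subst (_∈ M) (solve 1 (λ h → 𝟏 ⊜ inv h ⊕ 𝟏 ⊕ inv (inv h)) refl h) ε∈) ,
        λ x y x∈ y∈ → ∈-subset⁺ (conjugate? h M) (subst (_∈ M) (sym (conj-homo (h ⁻¹) x y))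
          (∙∈ _ _ (∈-subset⁻ (conjugate? h M) x∈) (∈-subset⁻ (conjugate? h M) y∈)))

      conjugate-max : ∀ {h M} → h ∈ H → Max M → Max (conjugate h M)
      conjugate-max {h} {M} h∈ (N⊆M , sM , (M⊆H , u , u∈ , u∉) , max) =
        (λ x∈ → ∈-subset⁺ (conjugate? h M) (N⊆M (conjN _ _ h⁻¹∈ x∈))) ,
        conjugate-isSubgroup h sM ,
        ((λ {x} x∈ → subst (_∈ H) (conj-⁻¹ʳ h x) (conj-closed sH h∈ (M⊆H (∈-subset⁻ (conjugate? h M) x∈)))) ,
         conj h u , conj-closed sH h∈ u∈ , λ u∈′ → u∉ (subst (_∈ M) (conj-⁻¹ˡ h u) (∈-subset⁻ (conjugate? h M) u∈′))) ,
        λ L sL M^h⊆L (L⊆H , v , v∈ , v∉) {x} x∈ → ∈-subset⁺ (conjugate? h M)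
          (max (conjugate (h ⁻¹) L) (conjugate-isSubgroup (h ⁻¹) sL)
            (λ {m} m∈ → ∈-subset⁺ (conjugate? (h ⁻¹) L) (subst (_∈ L) (cong (λ g → conj g m) (solve 1 (λ h → h ⊜ inv (inv h)) refl h))
               (M^h⊆L (∈-subset⁺ (conjugate? h M) (subst (_∈ M) (sym (conj-⁻¹ˡ h m)) m∈)))))
            ((λ {z} z∈ → subst (_∈ H) (conj-⁻¹ʳ (h ⁻¹) z)
                (conj-closed sH h⁻¹∈ (L⊆H (∈-subset⁻ (conjugate? (h ⁻¹) L) z∈)))) ,
             conj (h ⁻¹) v , conj-closed sH h⁻¹∈ v∈ ,
             λ v∈′ → v∉ (subst (_∈ L) (conj-⁻¹ˡ (h ⁻¹) v) (∈-subset⁻ (conjugate? (h ⁻¹) L) v∈′)))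
            (∈-subset⁺ (conjugate? (h ⁻¹) L) (subst (_∈ L) (sym (conj-⁻¹ˡ (h ⁻¹) x)) x∈)))
        where
        h⁻¹∈ = ⁻¹-closed sH h∈

      module ConjugacyClass {M x} (mx : Max M) (x∈M : x ∈ M) (x∉N : x ∉ N) where
        private
          N⊆M = proj₁ mx
          sM = proj₁ (proj₂ mx)
          M⊆H = proj₁ (proj₁ (proj₂ (proj₂ mx)))

        difference? : ∀ y → Dec (y ∈ M × y ∉ N)
        difference? y = (y ∈? M) ×-dec ¬? (y ∈? N)

        conjugator? : ∀ y g → Dec (g ∈ H × (conj (g ⁻¹) y ∈ M × conj (g ⁻¹) y ∉ N))
        conjugator? y g = (g ∈? H) ×-dec difference? (conj (g ⁻¹) y)

        class? : ∀ y → Dec (∃ λ g → g ∈ H × (conj (g ⁻¹) y ∈ M × conj (g ⁻¹) y ∉ N))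
        class? y = Fin.any? (conjugator? y)

        -- M and its conjugate by k share an element outside N, so `maximal-disjoint` makes k
        -- normalize M, and M is its own normalizer.
        ∈-of-conj : ∀ {k z} → k ∈ H → z ∈ M → conj k z ∈ M → conj k z ∉ N → k ∈ M
        ∈-of-conj {k} {z} k∈ z∈ kz∈ kz∉ = self-normalizing mx x∈M x∉N k k∈ λ m m∈ →
          maximal-disjoint (conjugate k M) M (conjugate-max k∈ mx) mx
            (conj k z , into z z∈ , kz∈ , kz∉) (into m m∈)
          where
          into : ∀ m → m ∈ M → conj k m ∈ conjugate k M
          into m m∈ = ∈-subset⁺ (conjugate? k M) (subst (_∈ M) (sym (conj-⁻¹ˡ k m)) m∈)

        -- If g₀ is one conjugator of y, then `∈-of-conj` identifies all of them with the coset g₀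
        -- M.
        conjugators : ∀ y → sum (λ g → 𝟙 (conjugator? y g)) ≡ 𝟙 (class? y) * count (_∈? M)
        conjugators y with class? y
        ... | no ¬c = sum-0 λ g → 𝟙-no (conjugator? y g) λ p → ¬c (g , p)
        ... | yes (g₀ , g₀∈ , z₀∈ , z₀∉) = trans (trans
          (sum-cong-≗ λ g → 𝟙-cong (conjugator? y g) (((g₀ ⁻¹) ∙ g) ∈? M) (forth g) (back g))
          (sum-reindex (λ g → 𝟙 (g ∈? M)) ((g₀ ⁻¹) ∙_) (g₀ ∙_)
            (solve 2 (λ g h → inv g ⊕ (g ⊕ h) ⊜ h) refl g₀) (solve 2 (λ g h → g ⊕ (inv g ⊕ h) ⊜ h) refl g₀)))
          (sym (ℕ.+-identityʳ _))
          where
          transport : ∀ g → conj ((g₀ ⁻¹) ∙ g) (conj (g ⁻¹) y) ≡ conj (g₀ ⁻¹) y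
          transport g = solve 3 (λ g₀ g y → let k = inv g₀ ⊕ g in
            k ⊕ (inv g ⊕ y ⊕ inv (inv g)) ⊕ inv k ⊜ inv g₀ ⊕ y ⊕ inv (inv g₀)) refl g₀ g y
          forth : ∀ g → g ∈ H × (conj (g ⁻¹) y ∈ M × conj (g ⁻¹) y ∉ N) → (g₀ ⁻¹) ∙ g ∈ M
          forth g (g∈ , z∈ , _) = ∈-of-conj (proj₂ sH _ _ (⁻¹-closed sH g₀∈) g∈) z∈
            (subst (_∈ M) (sym (transport g)) z₀∈) (subst (_∉ N) (sym (transport g)) z₀∉)
          back : ∀ g → (g₀ ⁻¹) ∙ g ∈ M → g ∈ H × (conj (g ⁻¹) y ∈ M × conj (g ⁻¹) y ∉ N)
          back g k∈ =
            subst (_∈ H) (solve 2 (λ g h → g ⊕ (inv g ⊕ h) ⊜ h) refl g₀ g) (proj₂ sH _ _ g₀∈ (M⊆H k∈)) ,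
            subst (_∈ M) (trans (cong (conj (k ⁻¹)) (sym (transport g))) (conj-⁻¹ˡ k _)) (conj-closed sM (⁻¹-closed sM k∈) z₀∈) ,
            λ z∈N → z₀∉ (subst (_∈ N) (transport g) (conjN k _ (M⊆H k∈) z∈N))
            where k = (g₀ ⁻¹) ∙ g

        conjugates : ∀ g → sum (λ y → 𝟙 (conjugator? y g)) ≡ 𝟙 (g ∈? H) * count difference?
        conjugates g = begin
          sum (λ y → 𝟙 (conjugator? y g))
            ≡⟨ sum-cong-≗ (λ y → 𝟙-× (g ∈? H) (difference? (conj (g ⁻¹) y))) ⟩
          sum (λ y → 𝟙 (g ∈? H) * 𝟙 (difference? (conj (g ⁻¹) y)))
            ≡⟨ *-distribˡ-sum (𝟙 (g ∈? H)) (λ y → 𝟙 (difference? (conj (g ⁻¹) y))) ⟨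
          𝟙 (g ∈? H) * sum (λ y → 𝟙 (difference? (conj (g ⁻¹) y)))
            ≡⟨ cong (𝟙 (g ∈? H) *_) (sum-reindex (λ y → 𝟙 (difference? y)) (conj (g ⁻¹)) (conj g) (conj-⁻¹ˡ g) (conj-⁻¹ʳ g)) ⟩
          𝟙 (g ∈? H) * count difference? ∎
          where open ≡-Reasoning

        -- Pairs (y, g) with y in the conjugate of M ─ N by g are counted by y and by g. In effect
        -- the conjugates of M, one for each coset, are disjoint outside N.
        doubleCount : count class? * count (_∈? M) ≡ count (_∈? H) * count difference?
        doubleCount = begin
          count class? * count (_∈? M)
            ≡⟨ *-distribʳ-sum (count (_∈? M)) (λ y → 𝟙 (class? y)) ⟩
          sum (λ y → 𝟙 (class? y) * count (_∈? M))
            ≡⟨ sum-cong-≗ conjugators ⟨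
          sum (λ y → sum (λ g → 𝟙 (conjugator? y g)))
            ≡⟨ ∑-comm (λ y g → 𝟙 (conjugator? y g)) ⟩
          sum (λ g → sum (λ y → 𝟙 (conjugator? y g)))
            ≡⟨ sum-cong-≗ conjugates ⟩
          sum (λ g → 𝟙 (g ∈? H) * count difference?)
            ≡⟨ *-distribʳ-sum (count difference?) (λ g → 𝟙 (g ∈? H)) ⟨
          count (_∈? H) * count difference? ∎
          where open ≡-Reasoning

        M-split : count (_∈? M) ≡ count difference? + count (_∈? N)
        M-split = ℕ.≤-antisym
          (count-cover difference? (_∈? N) (_∈? M) λ z z∈ → dec-split z z∈)
          (count-+ difference? (_∈? N) (_∈? M) (λ _ → proj₁) (λ _ → N⊆M) λ _ p q → proj₂ p q)
          where
          dec-split : ∀ z → z ∈ M → (z ∈ M × z ∉ N) ⊎ z ∈ N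
          dec-split z z∈ with z ∈? N
          ... | yes z∈N = inj₂ z∈N
          ... | no z∉N  = inj₁ (z∈ , z∉N)

        -- The coset x N lies in M and avoids N.
        N≤difference : count (_∈? N) ≤ count difference?
        N≤difference = ℕ.≤-trans (ℕ.≤-reflexive (sym (sum-reindex (λ y → 𝟙 (y ∈? N)) ((x ⁻¹) ∙_) (x ∙_)
            (solve 2 (λ g h → inv g ⊕ (g ⊕ h) ⊜ h) refl x) (solve 2 (λ g h → g ⊕ (inv g ⊕ h) ⊜ h) refl x))))
          (count-mono (λ y → ((x ⁻¹) ∙ y) ∈? N) difference? λ y y∈ →
            subst (_∈ M) (solve 2 (λ g h → g ⊕ (inv g ⊕ h) ⊜ h) refl x y) (proj₂ sM _ _ x∈M (N⊆M y∈)) ,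
            λ y∈N → x∉N (subst (_∈ N) (solve 2 (λ x y → y ⊕ inv (inv x ⊕ y) ⊜ x) refl x y)
              (proj₂ sN _ _ y∈N (⁻¹-closed sN y∈))))

        M<H : count (_∈? M) < count (_∈? H)
        M<H with proj₁ (proj₂ (proj₂ mx))
        ... | _ , u , u∈ , u∉ = ℕ.≤-trans (ℕ.≤-reflexive (ℕ.+-comm 1 _))
          (ℕ.≤-trans (ℕ.+-monoʳ-≤ (count (_∈? M)) (sum-≥1 {f = λ z → 𝟙 (z Fin.≟ u)} u (ℕ.≤-reflexive (sym (𝟙-yes (u Fin.≟ u) refl)))))
            (count-+ (_∈? M) (Fin._≟ u) (_∈? H) (λ _ → M⊆H) (λ { _ refl → u∈ }) λ { _ p refl → u∉ p }))

        -- At least half of M lies outside N, and `doubleCount` carries this proportion over to H.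
        class-half : count (_∈? H) ≤ 2 * count class?
        class-half = ℕ.*-cancelʳ-≤ η (2 * c) a {{ℕ.>-nonZero 0<a}} (begin
          η * a             ≡⟨ cong (η *_) M-split ⟩
          η * (b + ν)       ≤⟨ ℕ.*-monoʳ-≤ η (ℕ.+-monoʳ-≤ b N≤difference) ⟩
          η * (b + b)       ≡⟨ lemma₁ η b ⟩
          2 * (η * b)       ≡⟨ cong (2 *_) doubleCount ⟨
          2 * (c * a)       ≡⟨ ℕ.*-assoc 2 c a ⟨
          2 * c * a         ∎)
          where
          open ℕ.≤-Reasoning
          η = count (_∈? H)
          a = count (_∈? M)
          b = count difference?
          c = count class?
          ν = count (_∈? N)
          lemma₁ : ∀ η b → η * (b + b) ≡ 2 * (η * b)
          lemma₁ = solve-∀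
          0<a : 0 < a
          0<a = sum-≥1 x (ℕ.≤-reflexive (sym (𝟙-yes (x ∈? M) x∈M)))

        -- If the class and N covered H, then `doubleCount` would give |H| |N| ≤ |M| |N|, although M
        -- is proper.
        class-misses : ∃ λ z → z ∈ H × z ∉ N × ¬ (∃ λ g → g ∈ H × (conj (g ⁻¹) z ∈ M × conj (g ⁻¹) z ∉ N))
        class-misses with Fin.any? (λ z → (z ∈? H) ×-dec (¬? (z ∈? N) ×-dec ¬? (class? z)))
        ... | yes w = w
        ... | no ¬w = ⊥-elim (ℕ.<⇒≱ M<H (ℕ.*-cancelʳ-≤ η a ν {{ℕ.>-nonZero 0<ν}} (ℕ.+-cancelˡ-≤ (η * b) _ _ (begin
          η * b + η * ν   ≡⟨ ℕ.*-distribˡ-+ η b ν ⟨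
          η * (b + ν)     ≡⟨ cong (η *_) M-split ⟨
          η * a           ≤⟨ ℕ.*-monoˡ-≤ a (count-cover class? (_∈? N) (_∈? H) cover) ⟩
          (c + ν) * a     ≡⟨ lemma₂ c ν a ⟩
          c * a + a * ν   ≡⟨ cong (_+ a * ν) doubleCount ⟩
          η * b + a * ν   ∎))))
          where
          open ℕ.≤-Reasoning
          η = count (_∈? H)
          a = count (_∈? M)
          b = count difference?
          c = count class?
          ν = count (_∈? N)
          lemma₂ : ∀ c ν a → (c + ν) * a ≡ c * a + a * ν
          lemma₂ = solve-∀
          0<ν : 0 < ν
          0<ν = sum-≥1 ε (ℕ.≤-reflexive (sym (𝟙-yes (ε ∈? N) (proj₁ sN))))
          cover : ∀ z → z ∈ H → (∃ λ g → g ∈ H × (conj (g ⁻¹) z ∈ M × conj (g ⁻¹) z ∉ N)) ⊎ z ∈ N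
          cover z z∈ with class? z | z ∈? N
          ... | yes p | _      = inj₁ p
          ... | no _  | yes q  = inj₂ q
          ... | no ¬p | no ¬q  = ⊥-elim (¬w (z , z∈ , ¬q , ¬p))

      -- The conjugates of either of two nonconjugate maximal subgroups fill at least half of H, yet avoid N.
      trivial : ∀ x → x ∈ H → x ∉ N → ⊥
      trivial x x∈H x∉N with maximal-containing x x∈H x∉N
      ... | M₁ , mx₁ , x∈M₁ with ConjugacyClass.class-misses mx₁ x∈M₁ x∉N
      ... | z , z∈H , z∉N , z∉C₁ with maximal-containing z z∈H z∉N
      ... | M₂ , mx₂ , z∈M₂ = ℕ.<⇒≱ (ℕ.m<m+n (2 * η) (ℕ.*-mono-≤ (s≤s (z≤n {1})) 0<ν)) (begin
        2 * η + 2 * ν                       ≡⟨ cong (λ t → η + t + 2 * ν) (ℕ.+-identityʳ η) ⟩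
        η + η + 2 * ν                       ≤⟨ ℕ.+-monoˡ-≤ (2 * ν) (ℕ.+-mono-≤ C₁.class-half C₂.class-half) ⟩
        2 * c₁ + 2 * c₂ + 2 * ν             ≡⟨ lemma c₁ c₂ ν ⟩
        2 * (c₁ + c₂ + ν)                   ≤⟨ ℕ.*-monoʳ-≤ 2 total ⟩
        2 * η                               ∎)
        where
        open ℕ.≤-Reasoning
        module C₁ = ConjugacyClass mx₁ x∈M₁ x∉N
        module C₂ = ConjugacyClass mx₂ z∈M₂ z∉N
        η = count (_∈? H)
        ν = count (_∈? N)
        c₁ = count C₁.class?
        c₂ = count C₂.class?
        lemma : ∀ c₁ c₂ ν → 2 * c₁ + 2 * c₂ + 2 * ν ≡ 2 * (c₁ + c₂ + ν)
        lemma = solve-∀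
        0<ν : 0 < ν
        0<ν = sum-≥1 ε (ℕ.≤-reflexive (sym (𝟙-yes (ε ∈? N) (proj₁ sN))))
        Class : Subset n → Fin n → Set
        Class M y = ∃ λ g → g ∈ H × (conj (g ⁻¹) y ∈ M × conj (g ⁻¹) y ∉ N)
        in-H : ∀ {M} → Max M → ∀ y → Class M y → y ∈ H
        in-H mx y (g , g∈ , z∈ , _) = subst (_∈ H) (conj-⁻¹ʳ g y) (conj-closed sH g∈ (proj₁ (proj₁ (proj₂ (proj₂ mx))) z∈))
        not-N : ∀ {M} y → Class M y → y ∉ N
        not-N y (g , g∈ , _ , z∉) y∈ = z∉ (conjN _ _ (⁻¹-closed sH g∈) y∈)
        -- A common element puts a point outside N into M₂ and a conjugate of M₁. Then M₂ is
        -- contained in that conjugate, and so z would belong to the first class, against its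
        -- choice.
        disjoint : ∀ y → Class M₁ y → Class M₂ y → ⊥
        disjoint y (g , g∈ , p , p∉) (h , h∈ , q , q∉) = z∉C₁ (k , k∈ , z′∈ , λ z′∈N →
            z∉N (subst (_∈ N) (conj-⁻¹ʳ k z) (conjN k _ k∈ z′∈N)))
          where
          k = (h ⁻¹) ∙ g
          k∈ = proj₂ sH _ _ (⁻¹-closed sH h∈) g∈
          w = conj (h ⁻¹) y
          z′∈ : conj (k ⁻¹) z ∈ M₁
          z′∈ = ∈-subset⁻ (conjugate? k M₁) (maximal-disjoint M₂ (conjugate k M₁) mx₂ (conjugate-max k∈ mx₁)
            (w , q , ∈-subset⁺ (conjugate? k M₁) (subst (_∈ M₁)
              (solve 3 (λ g h y → let k = inv h ⊕ g in
                inv g ⊕ y ⊕ inv (inv g) ⊜ inv k ⊕ (inv h ⊕ y ⊕ inv (inv h)) ⊕ inv (inv k)) refl g h y) p) , q∉) z∈M₂)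
        total : c₁ + c₂ + ν ≤ η
        total = ℕ.≤-trans (ℕ.+-monoˡ-≤ ν (count-+ C₁.class? C₂.class? either? (λ _ → inj₁) (λ _ → inj₂) disjoint))
          (count-+ either? (_∈? N) (_∈? H)
            (λ { y (inj₁ p) → in-H mx₁ y p ; y (inj₂ q) → in-H mx₂ y q }) (λ _ → N⊆H)
            (λ { y (inj₁ p) y∈ → not-N y p y∈ ; y (inj₂ q) y∈ → not-N y q y∈ }))
          where
          either? : ∀ y → Dec (Class M₁ y ⊎ Class M₂ y)
          either? y = C₁.class? y ⊎-dec C₂.class? y

  -- No minimal counterexample is chosen. A recursive call on a proper subgroup, on the quotient by
  -- the centre or on the quotient by a normal S either already finds the configuration, which is
  -- passed on, or supplies the nilpotency that minimality would provide.
  nil-or-fixedPointFree : ∀ H N → IsSubgroup H → N ⊴ H → FixedPointFree ⊎ Nil H N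
  nil-or-fixedPointFree H N = go H N (<-wellFounded _)
    where
    go : ∀ H N → Acc _<_ ∣ H ─ N ∣ → IsSubgroup H → N ⊴ H → FixedPointFree ⊎ Nil H N
    go H N (acc rs) sH N⊴H@(sN , N⊆H , conjN) with ⊆-or-witness H N
    ... | inj₁ H⊆N = inj₂ (0 , λ _ → H⊆N)
    ... | inj₂ (x , x∈H , x∉N) with constant-or-all subgroups | ⊆-or-witness (centre H N) N
      where
      subgroups : ∀ S → FixedPointFree ⊎ (IsSubgroup S → N ⊆ S → S ⊂ H → Nil S N)
      subgroups S with isSubgroup? S ×-dec ((N ⊆? S) ×-dec (S ⊂? H))
      ... | no ¬p = inj₂ λ p q r → ⊥-elim (¬p (p , q , r))
      ... | yes (sS , N⊆S , S⊆H , u , u∈ , u∉)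
        with go S N (rs (p⊂q⇒∣p∣<∣q∣ (─-⊂ˡ N S⊆H (u , u∈ , u∉ , u∉ ∘ N⊆S)))) sS
               (sN , N⊆S , λ h x h∈ → conjN h x (S⊆H h∈))
      ... | inj₁ r = inj₁ r
      ... | inj₂ nil = inj₂ λ _ _ _ → nil
    ... | inj₁ r   | _ = inj₁ r
    ... | inj₂ nil | inj₂ (z , z∈ , z∉)
      with go H (centre H N) (rs (p⊂q⇒∣p∣<∣q∣ (─-⊂ʳ H (⊆-centre sH N⊴H) (z , proj₁ (proj₂ (centre-⊴ sH N⊴H)) z∈ , z∈ , z∉))))
             sH (centre-⊴ sH N⊴H)
    ...   | inj₁ r    = inj₁ r
    ...   | inj₂ nilZ = inj₂ (centre-nil nilZ)
    go H N (acc rs) sH N⊴H@(sN , N⊆H , conjN) | inj₂ (x , x∈H , x∉N) | inj₂ nil | inj₁ Z⊆N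
      with anySubset? (λ S → (S ⊴? H) ×-dec ((N ⊂? S) ×-dec (S ⊂? H)))
    ... | no ¬S = ⊥-elim (Simple.trivial (λ S p q r → ¬S (S , p , q , r)) x x∈H x∉N)
      where open CentrelessSection sH N⊴H nil (λ x x∈ cx → Z⊆N (∈-subset⁺ (centre? H N) (x∈ , cx)))
    ... | yes (S , S⊴H@(sS , _) , N⊂S@(N⊆S , u , u∈ , u∉) , S⊂H@(S⊆H , _))
      with go H S (rs (p⊂q⇒∣p∣<∣q∣ (─-⊂ʳ H N⊆S (u , S⊆H u∈ , u∈ , u∉)))) sH S⊴H
    ...   | inj₁ r    = inj₁ r
    ...   | inj₂ nilQ = inj₁ (nilpotentQuotient S sS N⊂S S⊂H nilQ)
      where open CentrelessSection sH N⊴H nil (λ x x∈ cx → Z⊆N (∈-subset⁺ (centre? H N) (x∈ , cx)))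

-- Laws of the wreath product

-- What a letter does as seen from one orbit of the automaton; `idle` is the part of the lamp that
-- the orbit never meets.
data Role (m : ℕ) : Set where
  lamp idle : Role m
  step      : Fin m → Role m

-- With its lamps replaced by the identity, a word evaluates to a pure power of z, which can then be
-- cancelled from its value with the lamps on.
unlit : ∀ {m} → Role m → Role m
unlit lamp     = idle
unlit idle     = idle
unlit (step j) = step j

module _ {n m : ℕ} (κ : Fin n → Role m) where

  displacement : List (Fin n) → Vec ℕ m
  displacement []      = replicate m 0
  displacement (i ∷ w) with κ i
  ... | step j = updateAt (displacement w) j suc
  ... | lamp   = displacement w
  ... | idle   = displacement w

  -- Words act from right to left.
  switches : List (Fin n) → List (Vec ℕ m)
  switches []      = []
  switches (i ∷ w) with κ i
  ... | step j = switches w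
  ... | lamp   = displacement w ∷ switches w
  ... | idle   = switches w

displacement-unlit : ∀ {n m} (κ : Fin n → Role m) w → displacement (unlit ∘ κ) w ≡ displacement κ w
displacement-unlit κ []      = refl
displacement-unlit κ (i ∷ w) with κ i
... | step j = cong (λ d → updateAt d j suc) (displacement-unlit κ w)
... | lamp   = displacement-unlit κ w
... | idle   = displacement-unlit κ w

switches-unlit : ∀ {n m} (κ : Fin n → Role m) w → switches (unlit ∘ κ) w ≡ []
switches-unlit κ []      = refl
switches-unlit κ (i ∷ w) with κ i
... | step j = switches-unlit κ w
... | lamp   = switches-unlit κ w
... | idle   = switches-unlit κ w

dot-0 : ∀ {m} (e : Vec ℕ m) → dot e (replicate m 0) ≡ 0
dot-0 []       = refl
dot-0 (e ∷ es) = cong₂ _+_ (ℕ.*-zeroʳ e) (dot-0 es)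

0-dot : ∀ {m} (d : Vec ℕ m) → dot (replicate m 0) d ≡ 0
0-dot []       = refl
0-dot (d ∷ ds) = 0-dot ds

dot-suc : ∀ {m} (e d : Vec ℕ m) j → dot e (updateAt d j suc) ≡ lookup e j + dot e d
dot-suc (e ∷ es) (d ∷ ds) zero    = trans (cong (_+ dot es ds) (ℕ.*-suc e d)) (ℕ.+-assoc e _ _)
dot-suc (e ∷ es) (d ∷ ds) (suc j) = trans (cong (e * d +_) (dot-suc es ds j)) (begin
  e * d + (lookup es j + dot es ds)  ≡⟨ ℕ.+-assoc (e * d) _ _ ⟨
  e * d + lookup es j + dot es ds    ≡⟨ cong (_+ dot es ds) (ℕ.+-comm (e * d) _) ⟩
  lookup es j + e * d + dot es ds    ≡⟨ ℕ.+-assoc (lookup es j) _ _ ⟩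
  lookup es j + (e * d + dot es ds)  ∎)
  where open ≡-Reasoning

unit : ∀ {m} → Fin m → Vec ℕ m
unit zero    = 1 ∷ replicate _ 0
unit (suc j) = 0 ∷ unit j

unit-dot : ∀ {m} j (d : Vec ℕ m) → dot (unit j) d ≡ lookup d j
unit-dot zero    (d ∷ ds) = trans (cong₂ _+_ (ℕ.+-identityʳ d) (0-dot ds)) (ℕ.+-identityʳ d)
unit-dot (suc j) (d ∷ ds) = unit-dot j ds

wordProduct : {A : Set} → (A → A → A) → A → ∀ {n} → (Fin n → A) → List (Fin n) → A
wordProduct _∙_ ε γ []      = ε
wordProduct _∙_ ε γ (i ∷ w) = γ i ∙ wordProduct _∙_ ε γ w

-- The two congruences say that w and w′ act equally in the wreath product of C_p by C_q^m.
LampLaws : ℕ → ℕ → ∀ {n} → List (Fin n) → List (Fin n) → Set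
LampLaws p q {n} w w′ = ∀ {m} (κ : Fin n → Role m) →
  (∀ j → Congruent q (lookup (displacement κ w) j) (lookup (displacement κ w′) j)) ×
  (∀ τ → Congruent p (hits q τ (switches κ w)) (hits q τ (switches κ w′)))

module SectionLaws {o : ℕ} {_∙_ : Op₂ (Fin o)} {ε : Fin o} {_⁻¹ : Op₁ (Fin o)}
                   (isGroup : IsGroup _≡_ _∙_ ε _⁻¹) where
  private
    grp : Group _ _
    grp = record { isGroup = isGroup }
  open Group grp using (assoc; identityˡ; identityʳ; inverseˡ; inverseʳ; monoid)
  open GroupProperties grp using (∙-cancelˡ)
  open GroupSolver isGroup
  open FiniteGroupTheory isGroup
  open Mult monoid using () renaming (_×_ to infixr 8 _·_; ×-homo-+ to ·-homo-+)

  module _ (R : FixedPointFree) where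
    open FixedPointFree R

    sectionGroup : AbelianGroup 0ℓ 0ℓ
    sectionGroup = record
      { Carrier = Σ (Fin o) (_∈ A)
      ; _≈_ = λ (a , _) (b , _) → a ∙ (b ⁻¹) ∈ N
      ; _∙_ = λ (a , a∈) (b , b∈) → a ∙ b , proj₂ sub-A _ _ a∈ b∈
      ; ε = ε , proj₁ sub-A
      ; _⁻¹ = λ (a , a∈) → a ⁻¹ , ⁻¹-closed sub-A a∈
      ; isAbelianGroup = record
        { isGroup = record
          { isMonoid = record
            { isSemigroup = record
              { isMagma = record
                { isEquivalence = record
                  { refl = λ {(a , _)} → ≡⇒≈ refl
                  ; sym = λ {(a , _)} {(b , _)} ab → subst (_∈ N)
                      (solve 2 (λ a b → inv (a ⊕ inv b) ⊜ b ⊕ inv a) refl a b) (⁻¹-closed sub-N ab)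
                  ; trans = λ {(a , _)} {(b , _)} {(c , _)} ab bc → subst (_∈ N)
                      (solve 3 (λ a b c → (a ⊕ inv b) ⊕ (b ⊕ inv c) ⊜ a ⊕ inv c) refl a b c) (proj₂ sub-N _ _ ab bc) }
                ; ∙-cong = λ {(a , a∈)} {(b , _)} {(c , _)} {(d , _)} ab cd → subst (_∈ N)
                    (solve 4 (λ a b c d → (a ⊕ (c ⊕ inv d) ⊕ inv a) ⊕ (a ⊕ inv b) ⊜ (a ⊕ c) ⊕ inv (b ⊕ d)) refl a b c d)
                    (proj₂ sub-N _ _ (A-N a _ a∈ cd) ab) }
              ; assoc = λ (a , _) (b , _) (c , _) → ≡⇒≈ (assoc a b c) }
            ; identity = (λ (a , _) → ≡⇒≈ (identityˡ a)) , (λ (a , _) → ≡⇒≈ (identityʳ a)) }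
          ; inverse = (λ (a , _) → ≡⇒≈ (inverseˡ a)) , (λ (a , _) → ≡⇒≈ (inverseʳ a))
          ; ⁻¹-cong = λ {(a , a∈)} {(b , _)} ab → subst (_∈ N)
              (solve 2 (λ a b → inv a ⊕ inv (a ⊕ inv b) ⊕ inv (inv a) ⊜ inv a ⊕ inv (inv b)) refl a b)
              (A-N _ _ (⁻¹-closed sub-A a∈) (⁻¹-closed sub-N ab)) }
        ; comm = λ (a , a∈) (b , b∈) → subst (_∈ N)
            (solve 2 (λ a b → a ⊕ b ⊕ inv a ⊕ inv b ⊜ (a ⊕ b) ⊕ inv (b ⊕ a)) refl a b) (abel a b a∈ b∈) } }
      where
      ≡⇒≈ : ∀ {a b} → a ≡ b → a ∙ (b ⁻¹) ∈ N
      ≡⇒≈ {a} refl = subst (_∈ N) (sym (inverseʳ a)) (proj₁ sub-N)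

    open Endomorphisms sectionGroup using (C; _≈_; 0#; _⊹_; IsEndo; iter-isEndo; module Descent; module Fourier)
      renaming (_·_ to infixr 8 _⋆_)

    ≡⇒≈ : ∀ (a b : C) → proj₁ a ≡ proj₁ b → a ≈ b
    ≡⇒≈ (a , _) _ refl = subst (_∈ N) (sym (inverseʳ a)) (proj₁ sub-N)

    ω : C → C
    ω (a , a∈) = conj y a , y-A a a∈

    ω-isEndo : IsEndo ω
    ω-isEndo = record
      { cong = λ {(a , _)} {(b , _)} ab → subst (_∈ N)
          (solve 3 (λ y a b → y ⊕ (a ⊕ inv b) ⊕ inv y ⊜ (y ⊕ a ⊕ inv y) ⊕ inv (y ⊕ b ⊕ inv y)) refl y a b) (y-N _ ab)
      ; homo = λ a b → ≡⇒≈ (ω (a ⊹ b)) (ω a ⊹ ω b) (conj-homo y _ _) }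

    ≈0⇒∈ : ∀ {x : C} → x ≈ 0# → proj₁ x ∈ N
    ≈0⇒∈ {a , _} = subst (_∈ N) (solve 1 (λ a → a ⊕ inv 𝟏 ⊜ a) refl a)

    ∈⇒≈0 : ∀ {x : C} → proj₁ x ∈ N → x ≈ 0#
    ∈⇒≈0 {a , _} = subst (_∈ N) (solve 1 (λ a → a ⊜ a ⊕ inv 𝟏) refl a)

    ω-free : ∀ x → ω x ≈ x → x ≈ 0#
    -- `ω x ≈ x` unfolds to `comm y a ∈ N`.
    ω-free x@(a , a∈) fx = ∈⇒≈0 {x} (free a a∈ fx)

    iter-ω : ∀ k x → proj₁ (iter ω k x) ≡ conj (k · y) (proj₁ x)
    iter-ω zero    x = sym (conj-ε _)
    iter-ω (suc k) x = trans (cong (conj y) (iter-ω k x)) (sym (conj-∙ y (k · y) _))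

    ⋆-proj₁ : ∀ k x → proj₁ (k ⋆ x) ≡ k · proj₁ x
    ⋆-proj₁ zero    x = refl
    ⋆-proj₁ (suc k) x = cong (proj₁ x ∙_) (⋆-proj₁ k x)

    open Descent (λ x → (proj₁ x ∙ (ε ⁻¹)) ∈? N)

    -- The prime p comes from an exponent killing a₀, while q and the power s of ω come from an
    -- exponent killing y.
    lampLaws : ∃ λ p → ∃ λ q → Prime p × Prime q × (∀ {n} (w w′ : List (Fin n)) →
      (∀ γ → wordProduct _∙_ ε γ w ≡ wordProduct _∙_ ε γ w′) → LampLaws p q w w′)
    lampLaws
      with finiteOrder a₀ | finiteOrder y
    ... | k , a₀ᵏ≡ε | r , yʳ≡ε
      with factorise (suc k) | factorise (suc r)
    ... | record { factors = ks ; isFactorisation = k≡ ; factorsPrime = pks } | record { factors = rs ; isFactorisation = r≡ ; factorsPrime = prs }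
      with primeTorsion {a₀ , a₀∈A} ks pks
             (≡⇒≈ (product ks ⋆ (a₀ , a₀∈A)) 0# (trans (⋆-proj₁ (product ks) _) (trans (cong (_· a₀) (sym k≡)) a₀ᵏ≡ε))) (λ eq → a₀∉N (≈0⇒∈ {a₀ , a₀∈A} eq))
    ... | p , pp , u , u≉0 , pu
      with coprimeAction ω-isEndo ω-free pp rs prs u u≉0 pu
             (≡⇒≈ (iter ω (product rs) u) u (trans (iter-ω (product rs) u) (trans (cong (λ g → conj g (proj₁ u)) (trans (cong (_· y) (sym r≡)) yʳ≡ε)) (conj-ε _))))
    ... | q , pq , q≢p , s , v , v≉0 , pv , fix , tr = p , q , pp , pq , laws
      where
      θ = iter ω s
      z = s · y
      Eθ = iter-isEndo ω-isEndo s
      open Fourier Eθ pp pq q≢p v≉0 pv fix tr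

      iter-θ : ∀ k x → proj₁ (iter θ k x) ≡ conj (k · z) (proj₁ x)
      iter-θ zero    x = sym (conj-ε _)
      iter-θ (suc k) x = trans (iter-ω s (iter θ k x)) (trans (cong (conj z) (iter-θ k x)) (sym (conj-∙ z (k · z) _)))

      pow-inverse : ∀ k → k · (z ⁻¹) ≡ (k · z) ⁻¹
      pow-inverse zero    = solve 0 (𝟏 ⊜ inv 𝟏) refl
      pow-inverse (suc k) = begin
        (z ⁻¹) ∙ (k · (z ⁻¹))  ≡⟨ cong ((z ⁻¹) ∙_) (pow-inverse k) ⟩
        (z ⁻¹) ∙ ((k · z) ⁻¹)  ≡⟨ solve 2 (λ z w → inv z ⊕ inv w ⊜ inv (w ⊕ z)) refl z (k · z) ⟩
        ((k · z) ∙ z) ⁻¹       ≡⟨ cong _⁻¹ (trans (cong ((k · z) ∙_) (sym (identityʳ z))) (trans (sym (·-homo-+ z k 1)) (cong (_· z) (ℕ.+-comm k 1)))) ⟩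
        (suc k · z) ⁻¹         ∎
        where open ≡-Reasoning

      -- The evaluation at frequency e. Steps go to powers of the inverse of z: collecting those on
      -- the left conjugates each v by a positive power of z, that is, applies an iterate of θ.
      assign : ∀ {m} → Vec ℕ m → Role m → Fin o
      assign e lamp     = proj₁ v
      assign e idle     = ε
      assign e (step j) = lookup e j · (z ⁻¹)

      wordProduct-assign : ∀ {n m} (κ : Fin n → Role m) e w →
        wordProduct _∙_ ε (assign e ∘ κ) w ≡ (dot e (displacement κ w) · (z ⁻¹)) ∙ proj₁ (transform (switches κ w) e)
      wordProduct-assign κ e [] = sym (trans (identityʳ _) (cong (_· (z ⁻¹)) (dot-0 e)))
      wordProduct-assign κ e (i ∷ w) with κ i
      ... | idle = trans (identityˡ _) (wordProduct-assign κ e w)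
      ... | step j = begin
        (lookup e j · (z ⁻¹)) ∙ wordProduct _∙_ ε (assign e ∘ κ) w  ≡⟨ cong ((lookup e j · (z ⁻¹)) ∙_) (wordProduct-assign κ e w) ⟩
        (lookup e j · (z ⁻¹)) ∙ ((dot e D · (z ⁻¹)) ∙ t)           ≡⟨ assoc _ _ _ ⟨
        ((lookup e j · (z ⁻¹)) ∙ (dot e D · (z ⁻¹))) ∙ t           ≡⟨ cong (_∙ t) (·-homo-+ (z ⁻¹) (lookup e j) (dot e D)) ⟨
        ((lookup e j + dot e D) · (z ⁻¹)) ∙ t                      ≡⟨ cong (λ k → (k · (z ⁻¹)) ∙ t) (dot-suc e D j) ⟨
        (dot e (updateAt D j suc) · (z ⁻¹)) ∙ t                    ∎
        where
        open ≡-Reasoning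
        D = displacement κ w
        t = proj₁ (transform (switches κ w) e)
      ... | lamp = begin
        proj₁ v ∙ wordProduct _∙_ ε (assign e ∘ κ) w               ≡⟨ cong (proj₁ v ∙_) (wordProduct-assign κ e w) ⟩
        proj₁ v ∙ ((E · (z ⁻¹)) ∙ t)                               ≡⟨ cong (λ g → proj₁ v ∙ (g ∙ t)) (pow-inverse E) ⟩
        proj₁ v ∙ (((E · z) ⁻¹) ∙ t)                               ≡⟨ solve 3 (λ v g t → v ⊕ (inv g ⊕ t) ⊜ inv g ⊕ ((g ⊕ v ⊕ inv g) ⊕ t)) refl (proj₁ v) (E · z) t ⟩
        ((E · z) ⁻¹) ∙ (conj (E · z) (proj₁ v) ∙ t)                ≡⟨ cong₂ (λ g c → g ∙ (c ∙ t)) (pow-inverse E) (iter-θ E v) ⟨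
        (E · (z ⁻¹)) ∙ (proj₁ (character (displacement κ w) e) ∙ t) ∎
        where
        open ≡-Reasoning
        E = dot e (displacement κ w)
        t = proj₁ (transform (switches κ w) e)

      laws : ∀ {n} (w w′ : List (Fin n)) →
             (∀ γ → wordProduct _∙_ ε γ w ≡ wordProduct _∙_ ε γ w′) → LampLaws p q w w′
      laws w w′ law {m} κ = displaced , λ τ → hits-congruent τ (switches κ w) (switches κ w′) λ e →
          ≡⇒≈ (transform (switches κ w) e) (transform (switches κ w′) e) (switched e)
        where
        open ≡-Reasoning
        unlit-product : ∀ e w → wordProduct _∙_ ε (assign e ∘ unlit ∘ κ) w ≡ dot e (displacement κ w) · (z ⁻¹)
        unlit-product e w = begin
          wordProduct _∙_ ε (assign e ∘ unlit ∘ κ) w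
            ≡⟨ wordProduct-assign (unlit ∘ κ) e w ⟩
          (dot e (displacement (unlit ∘ κ) w) · (z ⁻¹)) ∙ proj₁ (transform (switches (unlit ∘ κ) w) e)
            ≡⟨ cong₂ (λ d o → (dot e d · (z ⁻¹)) ∙ proj₁ (transform o e)) (displacement-unlit κ w) (switches-unlit κ w) ⟩
          (dot e (displacement κ w) · (z ⁻¹)) ∙ ε
            ≡⟨ identityʳ _ ⟩
          dot e (displacement κ w) · (z ⁻¹) ∎
        powers : ∀ e → dot e (displacement κ w) · (z ⁻¹) ≡ dot e (displacement κ w′) · (z ⁻¹)
        powers e = trans (sym (unlit-product e w)) (trans (law _) (unlit-product e w′))
        switched : ∀ e → proj₁ (transform (switches κ w) e) ≡ proj₁ (transform (switches κ w′) e)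
        switched e = ∙-cancelˡ (dot e (displacement κ w) · (z ⁻¹)) _ _ (begin
          (dot e (displacement κ w) · (z ⁻¹)) ∙ proj₁ (transform (switches κ w) e)    ≡⟨ wordProduct-assign κ e w ⟨
          wordProduct _∙_ ε (assign e ∘ κ) w                                          ≡⟨ law _ ⟩
          wordProduct _∙_ ε (assign e ∘ κ) w′                                         ≡⟨ wordProduct-assign κ e w′ ⟩
          (dot e (displacement κ w′) · (z ⁻¹)) ∙ proj₁ (transform (switches κ w′) e)  ≡⟨ cong (_∙ _) (powers e) ⟨
          (dot e (displacement κ w) · (z ⁻¹)) ∙ proj₁ (transform (switches κ w′) e)   ∎)
        -- The unit vector at j as frequency isolates the j-th coordinate, and conjugation by powers
        -- of z moves v with period q.
        displaced : ∀ j → Congruent q (lookup (displacement κ w) j) (lookup (displacement κ w′) j)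
        displaced j = exponent-congruent _ _ (≡⇒≈ (iter θ a v) (iter θ b v) (begin
          proj₁ (iter θ a v)       ≡⟨ iter-θ a v ⟩
          conj (a · z) (proj₁ v)   ≡⟨ cong (λ g → conj g (proj₁ v)) a·z≡b·z ⟩
          conj (b · z) (proj₁ v)   ≡⟨ iter-θ b v ⟨
          proj₁ (iter θ b v)       ∎))
          where
          a = lookup (displacement κ w) j
          b = lookup (displacement κ w′) j
          inverses : (a · z) ⁻¹ ≡ (b · z) ⁻¹
          inverses = begin
            (a · z) ⁻¹                                  ≡⟨ pow-inverse a ⟨
            a · (z ⁻¹)                                  ≡⟨ cong (_· (z ⁻¹)) (unit-dot j (displacement κ w)) ⟨
            dot (unit j) (displacement κ w) · (z ⁻¹)    ≡⟨ powers (unit j) ⟩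
            dot (unit j) (displacement κ w′) · (z ⁻¹)   ≡⟨ cong (_· (z ⁻¹)) (unit-dot j (displacement κ w′)) ⟩
            b · (z ⁻¹)                                  ≡⟨ pow-inverse b ⟩
            (b · z) ⁻¹                                  ∎
          a·z≡b·z : a · z ≡ b · z
          a·z≡b·z = trans (solve 1 (λ g → g ⊜ inv (inv g)) refl (a · z)) (trans (cong _⁻¹ inverses) (solve 1 (λ g → inv (inv g) ⊜ g) refl (b · z)))

-- The lamplighter automaton

iter-congruent : {A : Set} {f : A → A} {k : ℕ} → (∀ x → iter f k x ≡ x) →
                 ∀ {a b} → Congruent k a b → ∀ x → iter f a x ≡ iter f b x
iter-congruent {f = f} {k} cyc {a} {b} (c , d , eq) x =
  trans (sym (drop a c)) (trans (cong (λ i → iter f i x) eq) (drop b d))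
  where
  fixed : ∀ c → iter (iter f k) c x ≡ x
  fixed zero    = refl
  fixed (suc c) = trans (cyc _) (fixed c)
  drop : ∀ a c → iter f (a + c * k) x ≡ iter f a x
  drop a c = trans (iter-+ f a (c * k) x) (cong (iter f a) (trans (iter-* f c k x) (fixed c)))

iter-closed : {A : Set} (P : A → Set) {f : A → A} → (∀ x → P x → P (f x)) → ∀ k x → P x → P (iter f k x)
iter-closed P cl zero    x px = px
iter-closed P cl (suc k) x px = cl _ (iter-closed P cl k x px)

module _ {k : ℕ} where

  rot : Fin (suc k) → Fin (suc k)
  rot i = suc (toℕ i) mod suc k

  toℕ-mod : ∀ m → toℕ (m mod suc k) ≡ m % suc k
  toℕ-mod m = Fin.toℕ-fromℕ< (m%n<n m (suc k))

  toℕ-iter-rot : ∀ c i → toℕ (iter rot c i) ≡ (toℕ i + c) % suc k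
  toℕ-iter-rot zero    i = sym (trans (cong (_% suc k) (ℕ.+-identityʳ (toℕ i))) (m<n⇒m%n≡m (Fin.toℕ<n i)))
  toℕ-iter-rot (suc c) i = begin
    toℕ (rot (iter rot c i))               ≡⟨ toℕ-mod (suc (toℕ (iter rot c i))) ⟩
    suc (toℕ (iter rot c i)) % suc k       ≡⟨ cong (λ j → suc j % suc k) (toℕ-iter-rot c i) ⟩
    (1 + x % suc k) % suc k                ≡⟨ %-distribˡ-+ 1 (x % suc k) (suc k) ⟩
    (1 % suc k + x % suc k % suc k) % suc k ≡⟨ cong (λ j → (1 % suc k + j) % suc k) (m%n%n≡m%n x (suc k)) ⟩
    (1 % suc k + x % suc k) % suc k        ≡⟨ %-distribˡ-+ 1 x (suc k) ⟨
    suc x % suc k                          ≡⟨ cong (_% suc k) (ℕ.+-suc (toℕ i) c) ⟨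
    (toℕ i + suc c) % suc k                ∎
    where
    open ≡-Reasoning
    x = toℕ i + c

  iter-rot-cycle : ∀ i → iter rot (suc k) i ≡ i
  iter-rot-cycle i = Fin.toℕ-injective (trans (toℕ-iter-rot (suc k) i)
    (trans ([m+n]%n≡m%n (toℕ i) (suc k)) (m<n⇒m%n≡m (Fin.toℕ<n i))))

  rot-reaches : ∀ i j → ∃ λ c → iter rot c i ≡ j
  rot-reaches i j = (suc k ∸ toℕ i) + toℕ j , Fin.toℕ-injective (begin
    toℕ (iter rot ((suc k ∸ toℕ i) + toℕ j) i)     ≡⟨ toℕ-iter-rot _ i ⟩
    (toℕ i + ((suc k ∸ toℕ i) + toℕ j)) % suc k    ≡⟨ cong (_% suc k) (ℕ.+-assoc (toℕ i) _ (toℕ j)) ⟨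
    (toℕ i + (suc k ∸ toℕ i) + toℕ j) % suc k      ≡⟨ cong (λ x → (x + toℕ j) % suc k) (ℕ.m+[n∸m]≡n (ℕ.<⇒≤ (Fin.toℕ<n i))) ⟩
    (suc k + toℕ j) % suc k                        ≡⟨ cong (_% suc k) (ℕ.+-comm (suc k) (toℕ j)) ⟩
    (toℕ j + suc k) % suc k                        ≡⟨ [m+n]%n≡m%n (toℕ j) (suc k) ⟩
    toℕ j % suc k                                  ≡⟨ m<n⇒m%n≡m (Fin.toℕ<n j) ⟩
    toℕ j                                          ∎)
    where open ≡-Reasoning

  rot⁻¹ : Fin (suc k) → Fin (suc k)
  rot⁻¹ = iter rot k

  rot⁻¹-rot : ∀ i → rot⁻¹ (rot i) ≡ i
  rot⁻¹-rot i = trans (iter-suc rot k i) (iter-rot-cycle i)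

vec↔ : ∀ q m → Fin (q ^ m) ↔ Vec (Fin q) m
vec↔ q zero    = mk↔ₛ′ (λ _ → []) (λ _ → zero) (λ { [] → refl }) (λ { zero → refl })
vec↔ q (suc m) = ↔-trans Fin.*↔× (↔-trans (↔-refl ×-↔ vec↔ q m)
  (mk↔ₛ′ (λ (x , xs) → x ∷ xs) Vec.uncons (λ { (x ∷ xs) → refl }) (λ (x , xs) → refl)))

-- 𝔸* G S α is the automaton of the action α.

automaton : {Letter State : Set} → (Letter → State → State) → Alg
automaton {Letter} {State} act = record
  { Carrier = Letter × State
  ; f = λ x → proj₁ x , act (proj₁ x) (proj₂ x)
  ; d = λ x y → proj₁ x , proj₂ y }

first last : ∀ {n} → Term n → Fin n
first (Term.var i) = i
first (Term.f t)   = first t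
first (Term.d s t) = first s
last (Term.var i) = i
last (Term.f t)   = last t
last (Term.d s t) = last t

-- The state of `d s t` is that of t, so only the right spine counts; each f on it applies the
-- letter of its argument, which belongs to the first variable of that argument.
word : ∀ {n} → Term n → List (Fin n)
word (Term.var i) = []
word (Term.f t)   = first t ∷ word t
word (Term.d s t) = word t

module _ {Letter State : Set} (act : Letter → State → State) where

  run : ∀ {n} → (Fin n → Letter) → List (Fin n) → State → State
  run ρ []      x = x
  run ρ (i ∷ w) x = act (ρ i) (run ρ w x)

  ⟦⟧-automaton : ∀ {n} (t : Term n) ρ →
    ⟦ t ⟧ (automaton act) ρ ≡ (proj₁ (ρ (first t)) , run (proj₁ ∘ ρ) (word t) (proj₂ (ρ (last t))))
  ⟦⟧-automaton (Term.var i) ρ = refl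
  ⟦⟧-automaton (Term.f t)   ρ = cong (λ x → proj₁ x , act (proj₁ x) (proj₂ x)) (⟦⟧-automaton t ρ)
  ⟦⟧-automaton (Term.d s t) ρ = cong₂ (λ x y → proj₁ x , proj₂ y) (⟦⟧-automaton s ρ) (⟦⟧-automaton t ρ)

-- Lamp false sits at the origin of (ℤ/q)ᵐ and acts by α; lamp true sits at (q−1 , … , q−1) and acts by β.

module Lamplighter (p′ q′ L′ m : ℕ) where

  p q L : ℕ
  p = suc (suc p′)
  q = suc (suc q′)
  L = suc L′

  Fibre Position State Letter : Set
  Fibre = Fin p × Fin L
  Position = Vec (Fin q) m
  State = Position × Fibre
  Letter = Bool ⊎ Fin m

  α : Fibre → Fibre
  α (r , i) = rot r , i

  at-zero : (Fin L → Fin L) → Fin p → Fin L → Fin L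
  at-zero g zero    i = g i
  at-zero g (suc _) i = i

  -- Conjugating by σ moves only row zero, so the cycles of β link consecutive cycles of α.
  σ σ⁻¹ : Fibre → Fibre
  σ   (r , i) = r , at-zero rot r i
  σ⁻¹ (r , i) = r , at-zero rot⁻¹ r i

  σ⁻¹-σ : ∀ x → σ⁻¹ (σ x) ≡ x
  σ⁻¹-σ (zero  , i) = cong (zero ,_) (rot⁻¹-rot i)
  σ⁻¹-σ (suc r , i) = refl

  σ-σ⁻¹ : ∀ x → σ (σ⁻¹ x) ≡ x
  σ-σ⁻¹ (zero  , i) = cong (zero ,_) (iter-rot-cycle i)
  σ-σ⁻¹ (suc r , i) = refl

  β : Fibre → Fibre
  β x = σ (α (σ⁻¹ x))

  iter-α : ∀ k r i → iter α k (r , i) ≡ (iter rot k r , i)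
  iter-α zero    r i = refl
  iter-α (suc k) r i = cong α (iter-α k r i)

  iter-β : ∀ k x → iter β k (σ x) ≡ σ (iter α k x)
  iter-β zero    x = refl
  iter-β (suc k) x = trans (cong β (iter-β k x)) (cong (σ ∘ α) (σ⁻¹-σ (iter α k x)))

  π : Bool → Fibre → Fibre
  π false = α
  π true  = β

  π-order : ∀ c x → iter (π c) p x ≡ x
  π-order false (r , i) = trans (iter-α p r i) (cong (_, i) (iter-rot-cycle r))
  π-order true  x = begin
    iter β p x              ≡⟨ cong (iter β p) (σ-σ⁻¹ x) ⟨
    iter β p (σ (σ⁻¹ x))    ≡⟨ iter-β p (σ⁻¹ x) ⟩
    σ (iter α p (σ⁻¹ x))    ≡⟨ cong σ (π-order false (σ⁻¹ x)) ⟩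
    σ (σ⁻¹ x)               ≡⟨ σ-σ⁻¹ x ⟩
    x                       ∎
    where open ≡-Reasoning

  -- Chosen so that lamp c fires exactly where all shifted coordinates are divisible by q. This is
  -- the test in `hits`, with the shifted coordinates as τ.
  offset : Bool → ℕ
  offset false = 0
  offset true  = 1

  coordinates : Bool → Position → Vec ℕ m
  coordinates c = Vec.map (λ i → offset c + toℕ i)

  toggle : {P : Set} → Dec P → (Fibre → Fibre) → Fibre → Fibre
  toggle (yes _) g = g
  toggle (no _)  g = id

  toggle-yes : {P : Set} (P? : Dec P) → P → ∀ g x → toggle P? g x ≡ g x
  toggle-yes (yes _) _ g x = refl
  toggle-yes (no ¬p) p g x = ⊥-elim (¬p p)

  toggle-no : {P : Set} (P? : Dec P) → ¬ P → ∀ g x → toggle P? g x ≡ x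
  toggle-no (yes p) ¬p g x = ⊥-elim (¬p p)
  toggle-no (no _)  _  g x = refl

  act : Letter → State → State
  act (inj₁ c) (pos , x) = pos , toggle (allDivide? q (coordinates c pos)) (π c) x
  act (inj₂ j) (pos , x) = updateAt pos j rot , x

  shift : ∀ {m} → Vec (Fin q) m → Vec ℕ m → Vec (Fin q) m
  shift = zipWith (λ i c → iter rot c i)

  shift-0 : ∀ {m} (pos : Vec (Fin q) m) → shift pos (replicate m 0) ≡ pos
  shift-0 []        = refl
  shift-0 (i ∷ pos) = cong (i ∷_) (shift-0 pos)

  shift-suc : ∀ {m} (pos : Vec (Fin q) m) e j → shift pos (updateAt e j suc) ≡ updateAt (shift pos e) j rot
  shift-suc (i ∷ pos) (e ∷ es) zero    = refl
  shift-suc (i ∷ pos) (e ∷ es) (suc j) = cong (_ ∷_) (shift-suc pos es j)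

  shift-cong : ∀ {m} (pos : Vec (Fin q) m) e e′ → (∀ j → Congruent q (lookup e j) (lookup e′ j)) → shift pos e ≡ shift pos e′
  shift-cong []        []       []         cg = refl
  shift-cong (i ∷ pos) (e ∷ es) (e′ ∷ es′) cg =
    cong₂ _∷_ (iter-congruent iter-rot-cycle (cg zero) i) (shift-cong pos es es′ (cg ∘ suc))

  private
    split% : ∀ o x → o + x ≡ (x / q) * q + (o + x % q)
    split% o x = begin
      o + x                        ≡⟨ cong (o +_) (m≡m%n+[m/n]*n x q) ⟩
      o + (x % q + (x / q) * q)    ≡⟨ ℕ.+-assoc o (x % q) _ ⟨
      o + x % q + (x / q) * q      ≡⟨ ℕ.+-comm (o + x % q) _ ⟩
      (x / q) * q + (o + x % q)    ∎
      where open ≡-Reasoning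

    ∣-rot : ∀ o c (i : Fin q) → o + toℕ i + c ≡ ((toℕ i + c) / q) * q + (o + toℕ (iter rot c i))
    ∣-rot o c i = trans (ℕ.+-assoc o (toℕ i) c) (trans (split% o (toℕ i + c))
      (cong (λ x → ((toℕ i + c) / q) * q + (o + x)) (sym (toℕ-iter-rot c i))))

  fires⇒ : ∀ {m} o (pos : Vec (Fin q) m) e → AllDivide q (Vec.map (λ i → o + toℕ i) (shift pos e)) →
           AllDivide q (zipWith _+_ (Vec.map (λ i → o + toℕ i) pos) e)
  fires⇒ o []        []       []         = []
  fires⇒ o (i ∷ pos) (e ∷ es) (dv ∷ dvs) =
    subst (q ∣_) (sym (∣-rot o e i)) (∣m∣n⇒∣m+n (divides-refl ((toℕ i + e) / q)) dv) ∷ fires⇒ o pos es dvs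

  fires⇐ : ∀ {m} o (pos : Vec (Fin q) m) e → AllDivide q (zipWith _+_ (Vec.map (λ i → o + toℕ i) pos) e) →
           AllDivide q (Vec.map (λ i → o + toℕ i) (shift pos e))
  fires⇐ o []        []       []         = []
  fires⇐ o (i ∷ pos) (e ∷ es) (dv ∷ dvs) =
    ∣m+n∣m⇒∣n (subst (q ∣_) (∣-rot o e i) dv) (divides-refl ((toℕ i + e) / q)) ∷ fires⇐ o pos es dvs

  -- The role of the second lamp in an orbit where only the first one can fire.
  lit : Bool → Bool → Role m
  lit false false = lamp
  lit true  true  = lamp
  lit false true  = idle
  lit true  false = idle

  lit-view : ∀ c c′ → (c′ ≡ c × lit c c′ ≡ lamp) ⊎ (c′ ≡ not c × lit c c′ ≡ idle)
  lit-view false false = inj₁ (refl , refl)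
  lit-view true  true  = inj₁ (refl , refl)
  lit-view false true  = inj₂ (refl , refl)
  lit-view true  false = inj₂ (refl , refl)

  role : Bool → Letter → Role m
  role c (inj₁ c′) = lit c c′
  role c (inj₂ j)  = step j

  module _ {n : ℕ} (ρ : Fin n → Letter) (c : Bool) (pos : Position)
           (dark : ∀ w → ¬ AllDivide q (coordinates (not c) (shift pos (displacement (role c ∘ ρ) w)))) where

    -- With the other lamp dark, every change of the fibre is an application of the one permutation
    -- `π c`, so only the number of firings matters. A switch at displacement d fires when pos + d
    -- is the place of lamp c, which is what `hits` counts.
    run-lit : ∀ w x → run act ρ w (pos , x) ≡
      (shift pos (displacement (role c ∘ ρ) w) , iter (π c) (hits q (coordinates c pos) (switches (role c ∘ ρ) w)) x)
    run-lit []      x = cong (_, x) (sym (shift-0 pos))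
    run-lit (i ∷ w) x rewrite run-lit w x with ρ i
    ... | inj₂ j = cong (_, _) (sym (shift-suc pos (displacement (role c ∘ ρ) w) j))
    ... | inj₁ c′ with lit-view c c′
    ...   | inj₂ (refl , eq) rewrite eq =
      cong (shift pos (displacement (role c ∘ ρ) w) ,_) (toggle-no (allDivide? q _) (dark w) (π (not c)) _)
    ...   | inj₁ (refl , eq) rewrite eq with allDivide? q (zipWith _+_ (coordinates c pos) (displacement (role c ∘ ρ) w))
    ...     | yes all = cong (shift pos (displacement (role c ∘ ρ) w) ,_)
      (toggle-yes (allDivide? q _) (fires⇐ (offset c) pos _ all) (π c) _)
    ...     | no ¬all = cong (shift pos (displacement (role c ∘ ρ) w) ,_)
      (toggle-no (allDivide? q _) (¬all ∘ fires⇒ (offset c) pos _) (π c) _)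

  module _ {n : ℕ} (ρ : Fin n → Letter) (j : Fin m) (missing : ∀ i → ρ i ≢ inj₂ j) where

    displacement-missing : ∀ c w → lookup (displacement (role c ∘ ρ) w) j ≡ 0
    displacement-missing c [] = Vec.lookup-replicate j 0
    displacement-missing c (i ∷ w) with ρ i | missing i
    ... | inj₂ k | k≢j = trans (Vec.lookup∘updateAt′ j k (λ j≡k → k≢j (cong inj₂ (sym j≡k))) (displacement (role c ∘ ρ) w))
                           (displacement-missing c w)
    ... | inj₁ c′ | _ with lit-view c c′
    ...   | inj₁ (refl , eq) rewrite eq = displacement-missing c w
    ...   | inj₂ (refl , eq) rewrite eq = displacement-missing c w

    dark-of-coordinate : ∀ c pos → ¬ q ∣ offset (not c) + toℕ (lookup pos j) →
      ∀ w → ¬ AllDivide q (coordinates (not c) (shift pos (displacement (role c ∘ ρ) w)))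
    dark-of-coordinate c pos q∤ w all = q∤ (subst (q ∣_) (begin
      lookup (coordinates (not c) (shift pos D)) j       ≡⟨ Vec.lookup-map j _ (shift pos D) ⟩
      offset (not c) + toℕ (lookup (shift pos D) j)      ≡⟨ cong (λ i → offset (not c) + toℕ i) (begin
        lookup (shift pos D) j                             ≡⟨ Vec.lookup-zipWith _ j pos D ⟩
        iter rot (lookup D j) (lookup pos j)               ≡⟨ cong (λ k → iter rot k (lookup pos j)) (displacement-missing c w) ⟩
        lookup pos j                                       ∎) ⟩
      offset (not c) + toℕ (lookup pos j)                ∎) (VAll.lookup all (∈-lookup j _)))
      where
      open ≡-Reasoning
      D = displacement (role c ∘ ρ) w

    -- The immovable coordinate cannot be both 0 and q - 1, as q ≥ 2. If it is 0, lamp `true` is out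
    -- of reach, and otherwise lamp `false` is.
    dark-lamp : ∀ pos → ∃ λ c → ¬ q ∣ offset (not c) + toℕ (lookup pos j)
    dark-lamp pos with toℕ (lookup pos j) | Fin.toℕ<n (lookup pos j)
    ... | zero  | _   = false , λ q∣1 → contradiction (∣1⇒≡1 q∣1) λ ()
    ... | suc r | r<q = true , λ q∣r → ℕ.<⇒≱ r<q (∣⇒≤ q∣r)

    -- A position whose j-th coordinate never changes sees only one of the two lamps.
    run-law : ∀ w w′ → LampLaws p q w w′ → ∀ s → run act ρ w s ≡ run act ρ w′ s
    run-law w w′ laws (pos , x) with dark-lamp pos
    ... | c , q∤ = begin
      run act ρ w (pos , x)   ≡⟨ run-lit ρ c pos dark w x ⟩
      shift pos (displacement κ w) , iter (π c) (hits q τ (switches κ w)) x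
        ≡⟨ cong₂ _,_ (shift-cong pos _ _ (proj₁ (laws κ))) (iter-congruent (π-order c) (proj₂ (laws κ) τ) x) ⟩
      shift pos (displacement κ w′) , iter (π c) (hits q τ (switches κ w′)) x
        ≡⟨ run-lit ρ c pos dark w′ x ⟨
      run act ρ w′ (pos , x)  ∎
      where
      open ≡-Reasoning
      κ = role c ∘ ρ
      τ = coordinates c pos
      dark = dark-of-coordinate c pos q∤

  algebra : Alg
  algebra = automaton act

  letter↔ : Fin (2 + m) ↔ Letter
  letter↔ = ↔-trans Fin.+↔⊎ (Fin.2↔Bool ⊎-↔ ↔-refl)

  finite : Fin ((2 + m) * (q ^ m * (p * L))) ↔ Alg.Carrier algebra
  finite = ↔-trans Fin.*↔× (letter↔ ×-↔ ↔-trans Fin.*↔× (vec↔ q m ×-↔ Fin.*↔×))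

  L≤size : L ≤ (2 + m) * (q ^ m * (p * L))
  L≤size = ℕ.m≤n⇒m≤o*n (2 + m) (ℕ.m≤n⇒m≤o*n (q ^ m) {{ℕ.m^n≢0 q m}} (ℕ.m≤n*m L p))

  positions-closed : ∀ {m} (P : Vec (Fin q) m → Set) → (∀ j pos → P pos → P (updateAt pos j rot)) →
                     ∀ pos pos′ → P pos → P pos′
  positions-closed P cl []        []          ppos = ppos
  positions-closed P cl (i ∷ pos) (i′ ∷ pos′) ppos with rot-reaches i i′
  ... | c , refl = positions-closed (λ pos → P (iter rot c i ∷ pos)) (λ j pos → cl (suc j) (iter rot c i ∷ pos)) pos pos′
    (iter-closed (λ i → P (i ∷ pos)) (λ i → cl zero (i ∷ pos)) c i ppos)

  -- α joins the points with the same second component, and a trip along β from row one to row zero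
  -- raises that component by one.
  fibre-closed : (P : Fibre → Set) → (∀ c x → P x → P (π c x)) → P (zero , zero) → ∀ x → P x
  fibre-closed P cl p₀ (r , i) with rot-reaches zero i
  ... | c , refl = turn zero r _ (iter-closed (λ i → P (zero , i)) next c zero p₀)
    where
    turn : ∀ r r′ i → P (r , i) → P (r′ , i)
    turn r r′ i pr with rot-reaches r r′
    ... | k , refl = subst P (iter-α k r i) (iter-closed P (cl false) k (r , i) pr)
    next : ∀ i → P (zero , i) → P (zero , rot i)
    next i pz with rot-reaches {suc p′} (suc zero) zero
    -- σ fixes row one, which exists because p ≥ 2, so the trip starts untwisted and picks up the
    -- twist of σ on reaching row zero.
    ... | k , eq = subst P (begin
      iter β k (σ (suc zero , i))     ≡⟨ iter-β k (suc zero , i) ⟩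
      σ (iter α k (suc zero , i))     ≡⟨ cong σ (iter-α k (suc zero) i) ⟩
      σ (iter rot k (suc zero) , i)   ≡⟨ cong (λ r → σ (r , i)) eq ⟩
      (zero , rot i)                  ∎) (iter-closed P (cl true) k (suc zero , i) (turn zero (suc zero) i pz))
      where open ≡-Reasoning

  lampPosition : Bool → Fin q
  lampPosition false = zero
  lampPosition true  = iter rot (suc q′) zero

  lampPosition-fires : ∀ c → q ∣ offset c + toℕ (lampPosition c)
  lampPosition-fires false = q ∣0
  lampPosition-fires true  = subst (λ r → q ∣ suc r)
    (sym (trans (toℕ-iter-rot (suc q′) zero) (m<n⇒m%n≡m (ℕ.n<1+n (suc q′))))) ∣-refl

  module _ (P : State → Set) (cl : ∀ z s → P s → P (act z s)) where

    states-closed : P (replicate m zero , (zero , zero)) → ∀ s → P s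
    -- Quantifying over all positions in the induction on the fibre permits travelling to the lamp,
    -- firing it there and travelling away again.
    states-closed p₀ (pos , x) = fibre-closed (λ x → ∀ pos → P (pos , x)) lamps
      (λ pos → move _ pos _ p₀) x pos
      where
      move : ∀ pos pos′ x → P (pos , x) → P (pos′ , x)
      move pos pos′ x = positions-closed (λ pos → P (pos , x)) (λ j pos → cl (inj₂ j) (pos , x)) pos pos′
      lamps : ∀ c x → (∀ pos → P (pos , x)) → ∀ pos → P (pos , π c x)
      lamps c x all pos = move _ pos _ (subst (λ y → P (here , y))
        (toggle-yes (allDivide? q (coordinates c here)) (fires m) (π c) x) (cl (inj₁ c) (here , x) (all here)))
        where
        here = replicate m (lampPosition c)
        fires : ∀ m → AllDivide q (Vec.map (λ i → offset c + toℕ i) (replicate m (lampPosition c)))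
        fires zero    = []
        fires (suc m) = lampPosition-fires c ∷ fires m

  -- One generator for each letter, all in the same state. By d any letter can be put on any state
  -- already reached, so f can apply every letter there.
  generated : Generated (2 + m) algebra
  generated = gens , λ { (z , s) → let t , eq = reach s in
      Term.d (Term.var (Inverse.from letter↔ z)) t , cong₂ _,_ (Inverse.strictlyInverseˡ letter↔ z) eq }
    where
    gens : Fin (2 + m) → Letter × State
    gens i = Inverse.to letter↔ i , (replicate m zero , (zero , zero))
    Reachable : State → Set
    Reachable s = Σ (Term (2 + m)) λ t → proj₂ (⟦ t ⟧ algebra gens) ≡ s
    reach : ∀ s → Reachable s
    reach = states-closed Reachable
      (λ { z s (t , refl) → Term.f (Term.d (Term.var (Inverse.from letter↔ z)) t) , cong (λ z → act z s) (Inverse.strictlyInverseˡ letter↔ z) })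
      (Term.var zero , refl)

missing-step : ∀ {n} (ρ : Fin n → Bool ⊎ Fin (suc n)) → ∃ λ j → ∀ i → ρ i ≢ inj₂ j
missing-step {n} ρ with Fin.any? (λ j → Fin.all? (λ i → ¬? (Sum.≡-dec Bool._≟_ Fin._≟_ (ρ i) (inj₂ j))))
... | yes w = w
... | no ¬w = ⊥-elim (Fin.<⇒≢ (proj₁ (proj₂ (proj₂ ph))) (Sum.inj₂-injective
    (trans (sym (proj₂ (hit a))) (trans (cong ρ (proj₂ (proj₂ (proj₂ ph)))) (proj₂ (hit b))))))
  where
  hit : ∀ j → ∃ λ i → ρ i ≡ inj₂ j
  hit j = decidable-stable (Fin.any? (λ i → Sum.≡-dec Bool._≟_ Fin._≟_ (ρ i) (inj₂ j)))
    λ ¬h → ¬w (j , λ i eq → ¬h (i , eq))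
  ph = Fin.pigeonhole (ℕ.n<1+n n) (proj₁ ∘ hit)
  a = proj₁ ph
  b = proj₁ (proj₂ ph)

-- Identities of 𝔸*

module FinCopy (G : FiniteGroup) where
  open FiniteGroup G
  open IsGroup isGroup using (assoc; identityˡ; identityʳ; inverseˡ; inverseʳ)
  open Inverse enum using (to; from) renaming (strictlyInverseˡ to to-from; strictlyInverseʳ to from-to)

  infixl 7 _•_
  -- The group is transported to `Fin size`, where `Subset` and decidable quantification are
  -- available.
  _•_ : Op₂ (Fin size)
  x • y = from (to x ∙ to y)

  inverse : Op₁ (Fin size)
  inverse x = from (to x ⁻¹)

  copy-isGroup : IsGroup _≡_ _•_ (from ε) inverse
  copy-isGroup = record
    { isMonoid = record
      { isSemigroup = record
        { isMagma = record { isEquivalence = isEquivalence ; ∙-cong = cong₂ _•_ }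
        ; assoc = λ x y z → cong from (begin
            to (x • y) ∙ to z        ≡⟨ cong (_∙ to z) (to-from _) ⟩
            (to x ∙ to y) ∙ to z     ≡⟨ assoc _ _ _ ⟩
            to x ∙ (to y ∙ to z)     ≡⟨ cong (to x ∙_) (to-from _) ⟨
            to x ∙ to (y • z)        ∎) }
      ; identity = (λ x → trans (cong from (trans (cong (_∙ to x) (to-from ε)) (identityˡ _))) (from-to x))
                 , (λ x → trans (cong from (trans (cong (to x ∙_) (to-from ε)) (identityʳ _))) (from-to x)) }
    ; inverse = (λ x → cong from (trans (cong (_∙ to x) (to-from _)) (inverseˡ _)))
              , (λ x → cong from (trans (cong (to x ∙_) (to-from _)) (inverseʳ _)))
    ; ⁻¹-cong = cong inverse }
    where open ≡-Reasoning

  open FiniteGroupTheory copy-isGroup using (FixedPointFree; Nil; Zᵣ; _⊴_; conj) renaming (comm to comm′)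
  open Sections copy-isGroup using (nil-or-fixedPointFree)

  to-comm : ∀ x g → to (comm′ x (from g)) ≡ comm (to x) g
  to-comm x g = begin
    to (((x • h) • inverse x) • inverse h)             ≡⟨ to-from _ ⟩
    to ((x • h) • inverse x) ∙ to (inverse h)          ≡⟨ cong₂ _∙_ (to-from _) (to-from _) ⟩
    (to (x • h) ∙ to (inverse x)) ∙ (to h ⁻¹)          ≡⟨ cong (_∙ (to h ⁻¹)) (cong₂ _∙_ (to-from _) (to-from _)) ⟩
    ((to x ∙ to h) ∙ (to x ⁻¹)) ∙ (to h ⁻¹)            ≡⟨ cong (comm (to x)) (to-from g) ⟩
    comm (to x) g                                      ∎
    where
    open ≡-Reasoning
    h = from g

  nilpotent : Nil ⊤ ⁅ from ε ⁆ → IsNilpotent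
  nilpotent (c , nil) = c , λ x → subst (Z c) (to-from x) (central c (from x) (nil (from x) ∈⊤))
    where
    central : ∀ c x → Zᵣ ⊤ ⁅ from ε ⁆ c x → Z c (to x)
    central zero    x x∈ = trans (cong to (x∈⁅y⁆⇒x≡y _ x∈)) (to-from ε)
    central (suc c) x z g = subst (Z c) (to-comm x g) (central c _ (z (from g) ∈⊤))

  fixedPointFree : ¬ IsNilpotent → FixedPointFree
  fixedPointFree ¬nil with nil-or-fixedPointFree ⊤ ⁅ from ε ⁆ (∈⊤ , λ _ _ _ _ → ∈⊤) trivial-⊴
    where
    open GroupSolver copy-isGroup
    trivial-⊴ : ⁅ from ε ⁆ ⊴ ⊤
    trivial-⊴ = (x∈⁅x⁆ _ , λ x y x∈ y∈ → subst (_∈ ⁅ from ε ⁆) (begin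
          from ε             ≡⟨ IsGroup.identityˡ copy-isGroup (from ε) ⟨
          from ε • from ε    ≡⟨ cong₂ _•_ (x∈⁅y⁆⇒x≡y _ x∈) (x∈⁅y⁆⇒x≡y _ y∈) ⟨
          x • y              ∎) (x∈⁅x⁆ _))
      , ⊆⊤
      , λ h x _ x∈ → subst (_∈ ⁅ from ε ⁆) (begin
          from ε             ≡⟨ solve 1 (λ h → 𝟏 ⊜ h ⊕ 𝟏 ⊕ inv h) refl h ⟩
          conj h (from ε)    ≡⟨ cong (conj h) (x∈⁅y⁆⇒x≡y _ x∈) ⟨
          conj h x           ∎) (x∈⁅x⁆ _)
      where open ≡-Reasoning
  ... | inj₁ r   = r
  ... | inj₂ nil = contradiction (nilpotent nil) ¬nil

  nontrivial : FixedPointFree → ∃ λ g → g ≢ ε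
  nontrivial R = to a₀ , λ eq → a₀∉N (subst (_∈ N) (trans (cong from (sym eq)) (from-to a₀)) (proj₁ sub-N))
    where open FixedPointFree R

  wordProduct-copy : ∀ {n} (γ : Fin n → Fin size) w →
                     to (wordProduct _•_ (from ε) γ w) ≡ wordProduct _∙_ ε (to ∘ γ) w
  wordProduct-copy γ []      = to-from ε
  wordProduct-copy γ (i ∷ w) = trans (to-from _) (cong (to (γ i) ∙_) (wordProduct-copy γ w))

  copy-law : ∀ {n} (w w′ : List (Fin n)) → (∀ γ → wordProduct _∙_ ε γ w ≡ wordProduct _∙_ ε γ w′) →
             ∀ γ → wordProduct _•_ (from ε) γ w ≡ wordProduct _•_ (from ε) γ w′
  copy-law w w′ law γ = begin
    wordProduct _•_ (from ε) γ w                 ≡⟨ from-to _ ⟨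
    from (to (wordProduct _•_ (from ε) γ w))     ≡⟨ cong from (wordProduct-copy γ w) ⟩
    from (wordProduct _∙_ ε (to ∘ γ) w)          ≡⟨ cong from (law (to ∘ γ)) ⟩
    from (wordProduct _∙_ ε (to ∘ γ) w′)         ≡⟨ cong from (wordProduct-copy γ w′) ⟨
    from (to (wordProduct _•_ (from ε) γ w′))    ≡⟨ from-to _ ⟩
    wordProduct _•_ (from ε) γ w′                ∎
    where open ≡-Reasoning

module Identities (G : FiniteGroup) {S : Set} {k : ℕ} (finite : Fin k ↔ S) (α : FaithfulAction G S) where
  open FiniteGroup G
  open FaithfulAction α
  open IsGroup isGroup using (inverseˡ)
  private
    grp : Group _ _
    grp = record { isGroup = isGroup }
  open GroupProperties grp using (∙-cancelˡ)

  _≟S_ : ∀ (x y : S) → Dec (x ≡ y)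
  x ≟S y = map′ (λ eq → trans (sym (Inverse.strictlyInverseˡ finite x)) (trans (cong (Inverse.to finite) eq) (Inverse.strictlyInverseˡ finite y)))
                (cong (Inverse.from finite)) (Inverse.from finite x Fin.≟ Inverse.from finite y)

  moved : ∀ g → g ≢ ε → ∃ λ s → act g s ≢ s
  moved g g≢ε with Fin.any? (λ i → ¬? (act g (Inverse.to finite i) ≟S Inverse.to finite i))
  ... | yes (i , eq) = Inverse.to finite i , eq
  ... | no ¬w = contradiction (faithful g λ s → decidable-stable (act g s ≟S s) λ neq →
      ¬w (Inverse.from finite s , subst (λ s → act g s ≢ s) (sym (Inverse.strictlyInverseˡ finite s)) neq)) g≢ε

  run-wordProduct : ∀ {n} (γ : Fin n → Carrier) w s → run act γ w s ≡ act (wordProduct _∙_ ε γ w) s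
  run-wordProduct γ []      s = sym (act-ε s)
  run-wordProduct γ (i ∷ w) s = trans (cong (act (γ i)) (run-wordProduct γ w s)) (sym (act-∙ _ _ s))

  run-ε : ∀ {n} (w : List (Fin n)) s → run act (const ε) w s ≡ s
  run-ε []      s = refl
  run-ε (i ∷ w) s = trans (act-ε _) (run-ε w s)

  act-injective : ∀ g h → (∀ s → act g s ≡ act h s) → g ≡ h
  act-injective g h eq = sym (∙-cancelˡ (h ⁻¹) _ _ (trans (inverseˡ h) (sym (faithful ((h ⁻¹) ∙ g) λ s → begin
    act ((h ⁻¹) ∙ g) s     ≡⟨ act-∙ _ _ s ⟩
    act (h ⁻¹) (act g s)   ≡⟨ cong (act (h ⁻¹)) (eq s) ⟩
    act (h ⁻¹) (act h s)   ≡⟨ act-∙ _ _ s ⟨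
    act ((h ⁻¹) ∙ h) s     ≡⟨ cong (λ g → act g s) (inverseˡ h) ⟩
    act ε s                ≡⟨ act-ε s ⟩
    s                      ∎))))
    where open ≡-Reasoning

  module _ {g₀ : Carrier} (g₀≢ε : g₀ ≢ ε) {n : ℕ} (s t : Term n) (law : 𝔸* G S α ⊨ s ≈ t) where

    private
      s₀ = proj₁ (moved g₀ g₀≢ε)

    normal-law : ∀ ρ → (proj₁ (ρ (first s)) , run act (proj₁ ∘ ρ) (word s) (proj₂ (ρ (last s)))) ≡
                       (proj₁ (ρ (first t)) , run act (proj₁ ∘ ρ) (word t) (proj₂ (ρ (last t))))
    normal-law ρ = trans (sym (⟦⟧-automaton act s ρ)) (trans (law ρ) (⟦⟧-automaton act t ρ))

    choose : {A : Set} → Fin n → A → A → Fin n → A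
    choose j x y i with i Fin.≟ j
    ... | yes _ = x
    ... | no _  = y

    choose-≡ : {A : Set} (j : Fin n) (x y : A) → choose j x y j ≡ x
    choose-≡ j x y with j Fin.≟ j
    ... | yes _  = refl
    ... | no neq = contradiction refl neq

    choose-separates : {A : Set} {x y : A} → x ≢ y → ∀ {i j} → choose j x y j ≡ choose j x y i → j ≡ i
    choose-separates {x = x} {y} x≢y {i} {j} eq with i Fin.≟ j
    ... | yes i≡j = sym i≡j
    ... | no _    = contradiction (trans (sym (choose-≡ j x y)) eq) x≢y

    -- Letters g₀ and ε tell the first variable of s from all others, since f and d preserve the
    -- leading letter.
    first-law : first s ≡ first t
    first-law = choose-separates g₀≢ε (cong proj₁ (normal-law λ i → choose (first s) g₀ ε i , s₀))

    -- When all letters are ε, a term returns the state of its last variable; a point moved by g₀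
    -- provides two states to tell variables apart.
    last-law : last s ≡ last t
    last-law = choose-separates (proj₂ (moved g₀ g₀≢ε)) (trans (sym (run-ε (word s) _))
      (trans (cong proj₂ (normal-law λ i → ε , choose (last s) (act g₀ s₀) s₀ i)) (run-ε (word t) _)))

    word-law : ∀ γ → wordProduct _∙_ ε γ (word s) ≡ wordProduct _∙_ ε γ (word t)
    word-law γ = act-injective _ _ λ x → trans (sym (run-wordProduct γ (word s) x))
      (trans (cong proj₂ (normal-law λ i → γ i , x)) (run-wordProduct γ (word t) x))

automaton-law : {Letter State : Set} (act : Letter → State → State) → ∀ {n} (s t : Term n) →
  first s ≡ first t → last s ≡ last t → (∀ ρ x → run act ρ (word s) x ≡ run act ρ (word t) x) → automaton act ⊨ s ≈ t
automaton-law act s t eqf eql eqw ρ = begin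
  ⟦ s ⟧ (automaton act) ρ                                                     ≡⟨ ⟦⟧-automaton act s ρ ⟩
  (proj₁ (ρ (first s)) , run act (proj₁ ∘ ρ) (word s) (proj₂ (ρ (last s))))   ≡⟨ cong₂ (λ i j → proj₁ (ρ i) , run act (proj₁ ∘ ρ) (word s) (proj₂ (ρ j))) eqf eql ⟩
  (proj₁ (ρ (first t)) , run act (proj₁ ∘ ρ) (word s) (proj₂ (ρ (last t))))   ≡⟨ cong (proj₁ (ρ (first t)) ,_) (eqw (proj₁ ∘ ρ) _) ⟩
  (proj₁ (ρ (first t)) , run act (proj₁ ∘ ρ) (word t) (proj₂ (ρ (last t))))   ≡⟨ ⟦⟧-automaton act t ρ ⟨
  ⟦ t ⟧ (automaton act) ρ                                                     ∎
  where open ≡-Reasoning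

prime-≥2 : ∀ {p} → Prime p → ∃ λ p′ → p ≡ suc (suc p′)
prime-≥2 {0}           pp = contradiction pp ¬prime[0]
prime-≥2 {1}           pp = contradiction pp ¬prime[1]
prime-≥2 {suc (suc p)} pp = p , refl

theorem1p1 : (G : FiniteGroup) → ¬ FiniteGroup.IsNilpotent G →
    (S : Set) (k : ℕ) → Fin k ↔ S → (α : FaithfulAction G S) →
    InherentlyNFBFinite (𝔸* G S α)
theorem1p1 G ¬nil S k finite α n _ = 3 + n , s≤s z≤n , large
  where
  open FiniteGroup G using (enum; ε)
  open FinCopy G using (fixedPointFree; nontrivial; _•_; copy-isGroup; copy-law)
  R = fixedPointFree ¬nil

  g₀≢ε = proj₂ (nontrivial R)
  open Identities G finite α

  lamplighter : ∀ {p q} → Prime p → Prime q → (∀ (w w′ : List (Fin n)) →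
    (∀ γ → wordProduct _•_ (Inverse.from enum ε) γ w ≡ wordProduct _•_ (Inverse.from enum ε) γ w′) → LampLaws p q w w′) →
    ∀ ℓ → 0 < ℓ → Σ Alg λ B → InVarN n (𝔸* G S α) B × FiniteOfSizeAtLeast ℓ B × Generated (3 + n) B
  lamplighter pp pq laws (suc ℓ) _ with prime-≥2 pp | prime-≥2 pq
  ... | p′ , refl | q′ , refl = algebra , inVariety , (_ , L≤size , Lamplighter.finite p′ q′ ℓ (suc n)) , generated
    where
    -- With n + 1 steps, n letters always miss one; the two lamps bring the number of generators to
    -- 3 + n. The parameter ℓ makes `L` equal to the requested size `suc ℓ`.
    open Lamplighter p′ q′ ℓ (suc n) using (algebra; act; run-law; L≤size; generated)
    inVariety : InVarN n (𝔸* G S α) algebra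
    inVariety s t law = automaton-law act s t (first-law g₀≢ε s t law) (last-law g₀≢ε s t law) λ ρ →
      run-law ρ (proj₁ (missing-step ρ)) (proj₂ (missing-step ρ)) (word s) (word t)
        (laws (word s) (word t) (copy-law (word s) (word t) (word-law g₀≢ε s t law)))

  large : ∀ ℓ → 0 < ℓ → Σ Alg λ B → InVarN n (𝔸* G S α) B × FiniteOfSizeAtLeast ℓ B × Generated (3 + n) B
  large = let p , q , pp , pq , laws = SectionLaws.lampLaws copy-isGroup R in lamplighter pp pq laws
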